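{- With $$R(s,t,\ell,u,v,w):=\sum_{n\ge 0}q^{s\binom{n}{2}+tn}\,r(\ell,u,v,w;n),\qquad r(\ell,u,v,w;n):=\sum_{j\ge 0}\frac{(-1)^j\,q^{uv\frac{j(j-1)}{2}+(w-u\ell)j}}{(q;q)_{n-uj}\,(q^{uv};q^{uv})_j},$$ the following identities hold: $$R(2,1,1,1,2,2)=(-q;q^2)_\infty,$$ $$R(2,2,1,1,2,2)=(-q^2;q^2)_\infty,$$ and, for every positive integer $m$, $$R(m,m,1,1,1,2)=\frac{(q^{2m};q^{2m})_\infty}{(q^m;q^{2m})_\infty}.$$
   Context: Here $(a;q)_\infty=\prod_{k\ge 0}(1-aq^k)$ and $(a;q)_n=(a;q)_\infty/(aq^n;q)_\infty$ for $n\in\mathbb{Z}$, so that $(a;q)_n=\prod_{k=0}^{n-1}(1-aq^k)$ for $n\ge 0$. By convention $\frac{1}{(q;q)_n}=0$ for $n<0$, so the sum defining $r(\ell,u,v,w;n)$ is finite when $u\geq 1$. The identities may be read as identities of formal power series in $q$, or of convergent series and products for complex $q$ with $|q|<1$. -}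

module Defs where

open import Data.Integer as ℤ using (ℤ; +_; -[1+_]; 0ℤ; 1ℤ; -1ℤ)
import Data.Integer.Properties as ℤₚ
open import Data.Nat as ℕ using (ℕ; zero; suc; NonZero; z≤n; s≤s)
open import Data.Nat.Combinatorics using (_C_)
open import Data.Nat.DivMod using (_/_)
import Data.Nat.Properties as ℕₚ
open import Data.Product using (∃-syntax)
open import Data.Vec using (Vec; []; _∷_; head)
open import Function using (_∘_)
open import Relation.Binary.PropositionalEquality

-- ∑< n f = f 0 + … + f (n - 1).
∑< : ℕ → (ℕ → ℤ) → ℤ
∑< zero    f = 0ℤ
∑< (suc n) f = f 0 ℤ.+ ∑< n (f ∘ suc)

-- Formal power series in q over ℤ; f n is the coefficient of q^n.
PowerSeries : Set
PowerSeries = ℕ → ℤ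

infix  9 q^_
infix  8 ⊝_
infixl 7 _⋆_ _⊘_
infixl 6 _⊖_

q^_ : ℕ → PowerSeries
(q^ zero)  zero    = 1ℤ
(q^ zero)  (suc n) = 0ℤ
(q^ suc c) zero    = 0ℤ
(q^ suc c) (suc n) = (q^ c) n

𝟘 𝟙 : PowerSeries
𝟘 n = 0ℤ
𝟙 = q^ 0

⊝_ : PowerSeries → PowerSeries
(⊝ f) n = ℤ.- f n

_⊖_ _⋆_ : PowerSeries → PowerSeries → PowerSeries
(f ⊖ g) n = f n ℤ.- g n
(f ⋆ g) n = ∑< (suc n) (λ i → f i ℤ.* g (n ℕ.∸ i))

-- Multiplicative inverse of a series f with constant coefficient 1 (see
-- ⋆-recip; the value is meaningless for other f).  The coefficients
-- g_n , … , g_0 of 1/f are computed in that order from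
-- g_{n+1} = - (f_1 g_n + f_2 g_{n-1} + … + f_{n+1} g_0).
dot : ∀ {n} → (ℕ → ℤ) → Vec ℤ n → ℤ
dot f []       = 0ℤ
dot f (x ∷ xs) = f 0 ℤ.* x ℤ.+ dot (f ∘ suc) xs

recipCoeffs : PowerSeries → (n : ℕ) → Vec ℤ (suc n)
recipCoeffs f zero    = 1ℤ ∷ []
recipCoeffs f (suc n) = (ℤ.- dot (f ∘ suc) (recipCoeffs f n)) ∷ recipCoeffs f n

recip : PowerSeries → PowerSeries
recip f n = head (recipCoeffs f n)

_⊘_ : PowerSeries → PowerSeries → PowerSeries
f ⊘ g = f ⋆ recip g

dot-recip : ∀ f h n → dot h (recipCoeffs f n) ≡ (h ⋆ recip f) n
dot-recip f h zero    = refl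
dot-recip f h (suc n) =
  cong (ℤ._+_ (h 0 ℤ.* recip f (suc n))) (dot-recip f (h ∘ suc) n)

⋆-recip : ∀ f → f 0 ≡ 1ℤ → f ⋆ recip f ≗ 𝟙
⋆-recip f f₀ zero rewrite f₀ = refl
⋆-recip f f₀ (suc n)
  rewrite f₀
        | ℤₚ.*-identityˡ (recip f (suc n))
        | sym (dot-recip f (f ∘ suc) n)
  = ℤₚ.+-inverseˡ (dot (f ∘ suc) (recipCoeffs f n))

-- poch a b n = (a ; q^b)_n = ∏_{k<n} (1 - a q^{bk}).
poch : PowerSeries → ℕ → ℕ → PowerSeries
poch a b zero    = 𝟙
poch a b (suc n) = (𝟙 ⊖ a ⋆ q^ (b ℕ.* n)) ⋆ poch a b n

-- poch∞ a b = (a ; q^b)_∞.  For b ≥ 1 the factors with k > N do not affect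
-- the coefficient of q^N (see poch-limit), so it can be read off from the
-- product over k ≤ N.
poch∞ : PowerSeries → (b : ℕ) .{{_ : NonZero b}} → PowerSeries
poch∞ a b N = poch a b (suc N) N

∑<-zero : ∀ n f → (∀ i → i ℕ.< n → f i ≡ 0ℤ) → ∑< n f ≡ 0ℤ
∑<-zero zero    f f≡0 = refl
∑<-zero (suc n) f f≡0
  rewrite f≡0 0 (s≤s z≤n) | ∑<-zero n (f ∘ suc) (λ i i<n → f≡0 (suc i) (s≤s i<n))
  = refl

q^-below : ∀ c i → i ℕ.< c → (q^ c) i ≡ 0ℤ
q^-below (suc c) zero    _         = refl
q^-below (suc c) (suc i) (s≤s i<c) = q^-below c i i<c

⋆q^-below : ∀ a c i → i ℕ.< c → (a ⋆ q^ c) i ≡ 0ℤ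
⋆q^-below a c i i<c = ∑<-zero (suc i) _ λ j _ →
  trans (cong (a j ℤ.*_) (q^-below c (i ℕ.∸ j) (ℕₚ.≤-<-trans (ℕₚ.m∸n≤m i j) i<c)))
        (ℤₚ.*-zeroʳ (a j))

poch-step : ∀ a b .{{_ : NonZero b}} n N → N ℕ.< n →
            poch a b (suc n) N ≡ poch a b n N
poch-step a b n N N<n = begin
  h 0 ℤ.* p N ℤ.+ ∑< N (λ i → h (suc i) ℤ.* p (N ℕ.∸ suc i))
    ≡⟨ cong₂ ℤ._+_ (cong (ℤ._* p N) (h≡𝟙 0 z≤n))
                   (∑<-zero N _ λ i i<N → cong (ℤ._* p (N ℕ.∸ suc i)) (h≡𝟙 (suc i) i<N)) ⟩
  1ℤ ℤ.* p N ℤ.+ 0ℤ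
    ≡⟨ ℤₚ.+-identityʳ _ ⟩
  1ℤ ℤ.* p N
    ≡⟨ ℤₚ.*-identityˡ (p N) ⟩
  p N ∎
  where
  open ≡-Reasoning
  h p : PowerSeries
  h = 𝟙 ⊖ a ⋆ q^ (b ℕ.* n)
  p = poch a b n
  h≡𝟙 : ∀ i → i ℕ.≤ N → h i ≡ 𝟙 i
  h≡𝟙 i i≤N = trans
    (cong (λ x → 𝟙 i ℤ.- x)
      (⋆q^-below a (b ℕ.* n) i
        (ℕₚ.≤-<-trans i≤N (ℕₚ.<-≤-trans N<n (ℕₚ.m≤n*m n b)))))
    (ℤₚ.+-identityʳ (𝟙 i))

poch-limit : ∀ a b .{{_ : NonZero b}} N d → poch a b (d ℕ.+ suc N) N ≡ poch∞ a b N
poch-limit a b N zero    = refl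
poch-limit a b N (suc d) =
  trans (poch-step a b (d ℕ.+ suc N) N (ℕₚ.m≤n+m (suc N) d)) (poch-limit a b N d)

-- 1/(q;q)_n for n ∈ ℤ, which is 0 when n < 0.
recip[q,q] : ℤ → PowerSeries
recip[q,q] (+ n)    = recip (poch (q^ 1) 1 n)
recip[q,q] -[1+ n ] = 𝟘

-- Formal Laurent series in q, needed because w - uℓ may be negative; F k is
-- the coefficient of q^k.  Only addition, shifts and limits are used, so
-- finiteness of the principal part is not recorded in the type.
Laurent : Set
Laurent = ℤ → ℤ

⌞_⌟ : PowerSeries → Laurent
⌞ f ⌟ (+ n)    = f n
⌞ f ⌟ -[1+ n ] = 0ℤ

-- shift e F is the product q^e F.
shift : ℤ → Laurent → Laurent
shift e F k = F (k ℤ.- e)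

-- q-adic convergence of ∑_{n≥0} F n to S: the partial sums eventually agree
-- with S in all degrees up to any given k.
infix 4 _sumsTo_

_sumsTo_ : (ℕ → Laurent) → Laurent → Set
F sumsTo S = ∀ k → ∃[ M ] ∀ K → M ℕ.≤ K → ∀ i → i ℤ.≤ k →
             ∑< K (λ n → F n i) ≡ S i

-- As u ≥ 1, the terms with j > n vanish because then n - uj < 0.
r : (ℓ u v w : ℕ) .{{_ : NonZero u}} .{{_ : NonZero v}} → ℕ → Laurent
r ℓ u v w n k = ∑< (suc n) λ j →
  (-1ℤ ℤ.^ j) ℤ.*
  shift (+ (u ℕ.* v ℕ.* (j ℕ.* (j ℕ.∸ 1) / 2)) ℤ.+ (+ w ℤ.- + (u ℕ.* ℓ)) ℤ.* + j)
        ⌞ recip[q,q] (+ n ℤ.- + (u ℕ.* j)) ⋆ recip (poch (q^ (u ℕ.* v)) (u ℕ.* v) j) ⌟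
        k

-- The series defining R(s,t,ℓ,u,v,w), as its sequence of terms; its value is
-- the S such that R s t ℓ u v w sumsTo S.
R : (s t ℓ u v w : ℕ) .{{_ : NonZero u}} .{{_ : NonZero v}} → ℕ → Laurent
R s t ℓ u v w n = shift (+ (s ℕ.* (n C 2) ℕ.+ t ℕ.* n)) (r ℓ u v w n)

{-# OPTIONS --safe #-}

-- The generating function of r(1,1,v,2;n) in n is (xq;q^v)_∞/(x;q)_∞, which is
-- 1/(x;q²)_∞ for v = 2 and 1/(1-x) for v = 1; the q-difference equation in x
-- behind this gives r(1,1,2,2;n) = 1/(q²;q²)_n and r(1,1,1,2;n) = 1.  The first
-- two identities are then Euler's ∑ z^n p^{n(n-1)/2}/(p;p)_n = (-z;p)_∞ at
-- p = q², and the third is Gauss's ∑ x^{n(n+1)/2} = (x²;x²)_∞/(x;x²)_∞ at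
-- x = q^m, the limit of a finite identity of Shanks.  Infinite sums are avoided
-- by computing in the rings of power series modulo q^{N+1}.
module Submission where

open import Algebra.Bundles using (CommutativeRing)
import Algebra.Properties.AbelianGroup
import Algebra.Properties.Ring
import Algebra.Properties.Semiring.Mult.TCOptimised
import Algebra.Solver.Ring
open import Algebra.Solver.Ring.AlmostCommutativeRing using (_-Raw-AlmostCommutative⟶_; fromCommutativeRing)
open import Algebra.Structures using (IsCommutativeRing)
open import Data.Integer as ℤ using (ℤ; +_; -[1+_]; 0ℤ; 1ℤ; -1ℤ)
import Data.Integer.Properties as ℤₚ
open import Data.Integer.Solver using (module +-*-Solver)
import Data.Maybe as Maybe
open import Data.Nat as ℕ using (ℕ; NonZero; _*_; zero; suc; z≤n; s≤s)
open import Data.Nat.Combinatorics using (_C_; nC1≡n; nCk+nC[k+1]≡[n+1]C[k+1])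
open import Data.Nat.Divisibility using (divides)
open import Data.Nat.DivMod using (_/_; +-distrib-/-∣ʳ; m*n/n≡m)
import Data.Nat.Properties as ℕₚ
open import Data.Nat.Properties using (m*n≢0)
import Data.Nat.Solver as ℕSolver
open import Data.Product using (_×_; _,_)
open import Function using (_∘_)
open import Level using (0ℓ)
open import Relation.Binary.PropositionalEquality
  using (_≡_; refl; sym; trans; cong; cong₂; subst; _≗_; module ≡-Reasoning)
import Relation.Binary.Reasoning.Setoid
open import Relation.Nullary.Decidable using (dec⇒maybe)
open import Defs

-- Power series modulo q^{N+1}

-- Write F(x) = 1/(x;q)_∞, G(x) = (xq;q^v)_∞ and H = FG. No series in x is ever formed: F(x) - F(qx)
-- = x F(x) and G(x) - G(q^v x) = -qx G(q^v x) enter as recurrences of coefficients, and replacing x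
-- by qx in F or by q^v x in G becomes a weight on the terms of a Cauchy product. The obstacle is
-- that applying these two equations leaves mixed terms such as G(q^v x)F(x), which are not
-- expressible by H alone. They are removed by subtracting the combination G(x)F(x) - G(q^v x)F(x) +
-- q G(q^v x)(F(x) - F(qx)), which is zero. What remains is (1-x)H(x) = H(q²x) for v = 2 and
-- (1-x)H(x) = (1-qx)H(qx) for v = 1. The sums over n need no limits either: a high power of q is
-- zero modulo q^{N+1}, so the identities of Euler and Gauss are proved in any commutative ring,
-- where the vanishing of suitable elements takes the place of a limit.

infixl 6 _⊕_
_⊕_ : PowerSeries → PowerSeries → PowerSeries
(f ⊕ g) n = f n ℤ.+ g n

infixr 7 _·_
_·_ : ℤ → PowerSeries → PowerSeries
(c · f) n = c ℤ.* f n

∑<-cong : ∀ n {f g} → (∀ i → i ℕ.< n → f i ≡ g i) → ∑< n f ≡ ∑< n g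
∑<-cong zero    f≡g = refl
∑<-cong (suc n) f≡g = cong₂ ℤ._+_ (f≡g 0 (s≤s z≤n)) (∑<-cong n λ i i<n → f≡g (suc i) (s≤s i<n))

-- Coefficient n of a product involves no coefficient beyond n, which is why multiplication respects
-- agreement modulo a power of q.
⋆-cong-at : ∀ {f f′ g g′} n → (∀ i → i ℕ.≤ n → f i ≡ f′ i) → (∀ i → i ℕ.≤ n → g i ≡ g′ i) →
            (f ⋆ g) n ≡ (f′ ⋆ g′) n
⋆-cong-at n f≡ g≡ = ∑<-cong (suc n) λ { i (s≤s i≤n) →
  cong₂ ℤ._*_ (f≡ i i≤n) (g≡ (n ℕ.∸ i) (ℕₚ.m∸n≤m n i)) }

-- The definition of `⋆` peels off the summand with `f 0`; peeling off the one with `g 0` instead is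
-- what commutativity by induction needs.
⋆-suc : ∀ f g n → (f ⋆ g) (suc n) ≡ (f ⋆ (g ∘ suc)) n ℤ.+ f (suc n) ℤ.* g 0
⋆-suc f g zero    = solve 2 (λ a b → a :+ (b :+ con 0ℤ) := (a :+ con 0ℤ) :+ b) refl
                      (f 0 ℤ.* g 1) (f 1 ℤ.* g 0)
  where open +-*-Solver
⋆-suc f g (suc n) = trans
  (cong (ℤ._+_ (f 0 ℤ.* g (suc (suc n)))) (⋆-suc (f ∘ suc) g n))
  (sym (ℤₚ.+-assoc (f 0 ℤ.* g (suc (suc n))) _ _))

⋆-comm : ∀ f g → f ⋆ g ≗ g ⋆ f
⋆-comm f g zero    = cong (ℤ._+ 0ℤ) (ℤₚ.*-comm (f 0) (g 0))
⋆-comm f g (suc n) = begin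
  f 0 ℤ.* g (suc n) ℤ.+ ((f ∘ suc) ⋆ g) n ≡⟨ cong₂ ℤ._+_ (ℤₚ.*-comm (f 0) _) (⋆-comm (f ∘ suc) g n) ⟩
  g (suc n) ℤ.* f 0 ℤ.+ (g ⋆ (f ∘ suc)) n ≡⟨ ℤₚ.+-comm (g (suc n) ℤ.* f 0) _ ⟩
  (g ⋆ (f ∘ suc)) n ℤ.+ g (suc n) ℤ.* f 0 ≡⟨ ⋆-suc g f n ⟨
  (g ⋆ f) (suc n)                         ∎
  where open ≡-Reasoning

⋆-distribʳ : ∀ f g h → (g ⊕ h) ⋆ f ≗ (g ⋆ f) ⊕ (h ⋆ f)
⋆-distribʳ f g h zero    =
  solve 3 (λ a b c → (b :+ c) :* a :+ con 0ℤ := (b :* a :+ con 0ℤ) :+ (c :* a :+ con 0ℤ)) refl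
    (f 0) (g 0) (h 0)
  where open +-*-Solver
⋆-distribʳ f g h (suc n) = trans
  (cong (ℤ._+_ ((g 0 ℤ.+ h 0) ℤ.* f (suc n))) (⋆-distribʳ f (g ∘ suc) (h ∘ suc) n))
  (solve 5 (λ a b c x y → (b :+ c) :* a :+ (x :+ y) := (b :* a :+ x) :+ (c :* a :+ y)) refl
    (f (suc n)) (g 0) (h 0) _ _)
  where open +-*-Solver

·-⋆ : ∀ c f g → (c · f) ⋆ g ≗ c · (f ⋆ g)
·-⋆ c f g zero    =
  solve 3 (λ c a b → c :* a :* b :+ con 0ℤ := c :* (a :* b :+ con 0ℤ)) refl c (f 0) (g 0)
  where open +-*-Solver
·-⋆ c f g (suc n) = trans
  (cong (ℤ._+_ (c ℤ.* f 0 ℤ.* g (suc n))) (·-⋆ c (f ∘ suc) g n))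
  (solve 4 (λ c a b x → c :* a :* b :+ c :* x := c :* (a :* b :+ x)) refl c (f 0) (g (suc n)) _)
  where open +-*-Solver

⋆-assoc : ∀ f g h → (f ⋆ g) ⋆ h ≗ f ⋆ (g ⋆ h)
⋆-assoc f g h zero    =
  solve 3 (λ a b c → (a :* b :+ con 0ℤ) :* c :+ con 0ℤ := a :* (b :* c :+ con 0ℤ) :+ con 0ℤ) refl
    (f 0) (g 0) (h 0)
  where open +-*-Solver
⋆-assoc f g h (suc n) = begin
  -- The tail of `f ⋆ g` is by definition `f 0 · (g ∘ suc) ⊕ (f ∘ suc) ⋆ g`.
  (f ⋆ g) 0 ℤ.* h (suc n) ℤ.+ ((f 0 · (g ∘ suc) ⊕ (f ∘ suc) ⋆ g) ⋆ h) n
    ≡⟨ cong (ℤ._+_ ((f ⋆ g) 0 ℤ.* h (suc n))) (trans (⋆-distribʳ h (f 0 · (g ∘ suc)) ((f ∘ suc) ⋆ g) n)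
         (cong₂ ℤ._+_ (·-⋆ (f 0) (g ∘ suc) h n) (⋆-assoc (f ∘ suc) g h n))) ⟩
  (f ⋆ g) 0 ℤ.* h (suc n) ℤ.+ (f 0 ℤ.* ((g ∘ suc) ⋆ h) n ℤ.+ ((f ∘ suc) ⋆ (g ⋆ h)) n)
    ≡⟨ solve 5 (λ a b c x y → (a :* b :+ con 0ℤ) :* c :+ (a :* x :+ y) := a :* (b :* c :+ x) :+ y) refl
         (f 0) (g 0) (h (suc n)) _ _ ⟩
  f 0 ℤ.* (g ⋆ h) (suc n) ℤ.+ ((f ∘ suc) ⋆ (g ⋆ h)) n ∎
  where
  open ≡-Reasoning
  open +-*-Solver

⋆-zeroˡ : ∀ f → 𝟘 ⋆ f ≗ 𝟘
⋆-zeroˡ f n = ∑<-zero (suc n) _ λ _ _ → refl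

⋆-identityˡ : ∀ f → 𝟙 ⋆ f ≗ f
⋆-identityˡ f zero    = trans (ℤₚ.+-identityʳ _) (ℤₚ.*-identityˡ (f 0))
⋆-identityˡ f (suc n) = trans
  (cong₂ ℤ._+_ (ℤₚ.*-identityˡ (f (suc n))) (⋆-zeroˡ f n)) (ℤₚ.+-identityʳ _)

q^-+ : ∀ a b → q^ (a ℕ.+ b) ≗ q^ a ⋆ q^ b
q^-+ zero    b n       = sym (⋆-identityˡ (q^ b) n)
q^-+ (suc a) b zero    = refl
q^-+ (suc a) b (suc n) = trans (q^-+ a b n) (sym (ℤₚ.+-identityˡ _))

infix 4 _≈[_]_

-- A record and not a bare function type, so that both series and `N` can be inferred from a proof
-- of congruence.
record _≈[_]_ (f : PowerSeries) (N : ℕ) (g : PowerSeries) : Set where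
  constructor agree
  field at : ∀ {i} → i ℕ.≤ N → f i ≡ g i
open _≈[_]_ public

≗⇒≈ : ∀ {N f g} → f ≗ g → f ≈[ N ] g
≗⇒≈ f≗g = agree λ {i} _ → f≗g i

-- The ring operations are opaque so that equations between series are not
-- compared coefficientwise by unfolding them.
opaque
  infixl 6 _⊞_
  infixl 7 _⊛_
  infix  8 ⊟_
  _⊞_ _⊛_ : PowerSeries → PowerSeries → PowerSeries
  _⊞_ = _⊕_
  _⊛_ = _⋆_
  ⊟_ : PowerSeries → PowerSeries
  ⊟_ = ⊝_

  isCommutativeRing : ∀ N → IsCommutativeRing _≈[ N ]_ _⊞_ _⊛_ ⊟_ 𝟘 𝟙
  isCommutativeRing N = record
    { *-comm = λ f g → ≗⇒≈ (⋆-comm f g)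
    ; isRing = record
      { +-isAbelianGroup = record
        { comm = λ f g → ≗⇒≈ λ n → ℤₚ.+-comm (f n) (g n)
        ; isGroup = record
          { ⁻¹-cong = λ f≈ → agree λ i≤N → cong ℤ.-_ (at f≈ i≤N)
          ; inverse = (λ f → ≗⇒≈ λ n → ℤₚ.+-inverseˡ (f n)) , (λ f → ≗⇒≈ λ n → ℤₚ.+-inverseʳ (f n))
          ; isMonoid = record
            { identity = (λ f → ≗⇒≈ λ n → ℤₚ.+-identityˡ (f n)) , (λ f → ≗⇒≈ λ n → ℤₚ.+-identityʳ (f n))
            ; isSemigroup = record
              { assoc = λ f g h → ≗⇒≈ λ n → ℤₚ.+-assoc (f n) (g n) (h n)
              ; isMagma = record
                { ∙-cong = λ f≈ g≈ → agree λ i≤N → cong₂ ℤ._+_ (at f≈ i≤N) (at g≈ i≤N)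
                ; isEquivalence = record
                  { refl  = agree λ _ → refl
                  ; sym   = λ f≈ → agree λ i≤N → sym (at f≈ i≤N)
                  ; trans = λ f≈ g≈ → agree λ i≤N → trans (at f≈ i≤N) (at g≈ i≤N)
                  } } } } } }
      ; *-cong = λ f≈ g≈ → agree λ {n} n≤N → ⋆-cong-at n
          (λ i i≤n → at f≈ (ℕₚ.≤-trans i≤n n≤N)) (λ i i≤n → at g≈ (ℕₚ.≤-trans i≤n n≤N))
      ; *-assoc = λ f g h → ≗⇒≈ (⋆-assoc f g h)
      ; *-identity = (λ f → ≗⇒≈ (⋆-identityˡ f))
                   , (λ f → ≗⇒≈ λ n → trans (⋆-comm f 𝟙 n) (⋆-identityˡ f n))
      ; distrib = (λ f g h → ≗⇒≈ λ n → trans (⋆-comm f (g ⊕ h) n) (trans (⋆-distribʳ f g h n)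
                     (cong₂ ℤ._+_ (⋆-comm g f n) (⋆-comm h f n))))
                , (λ f g h → ≗⇒≈ (⋆-distribʳ f g h))
      } }

⋆-commutativeRing : ℕ → CommutativeRing 0ℓ 0ℓ
⋆-commutativeRing N = record { isCommutativeRing = isCommutativeRing N }

-- q-series identities in a commutative ring

triangular : ℕ → ℕ
triangular zero    = 0
triangular (suc n) = suc n ℕ.+ triangular n

-- The exponent n(2n+1) is that of the diagonal term `term n n` in Shanks' sum; this is how
-- triangular numbers enter there.
triangular-2* : ∀ n → triangular (2 * n) ≡ n * (1 ℕ.+ 2 * n)
triangular-2* zero    = refl
triangular-2* (suc n) = begin
  triangular (2 * suc n)                                        ≡⟨ cong triangular (ℕₚ.*-suc 2 n) ⟩
  2 ℕ.+ 2 * n ℕ.+ (1 ℕ.+ 2 * n ℕ.+ triangular (2 * n))          ≡⟨ cong (λ t → 2 ℕ.+ 2 * n ℕ.+ (1 ℕ.+ 2 * n ℕ.+ t)) (triangular-2* n) ⟩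
  2 ℕ.+ 2 * n ℕ.+ (1 ℕ.+ 2 * n ℕ.+ n * (1 ℕ.+ 2 * n))           ≡⟨ solve 1 (λ n →
    con 2 :+ con 2 :* n :+ (con 1 :+ con 2 :* n :+ n :* (con 1 :+ con 2 :* n)) :=
    (con 1 :+ n) :* (con 1 :+ con 2 :* (con 1 :+ n))) refl n ⟩
  suc n * (1 ℕ.+ 2 * suc n)                                     ∎
  where
  open ≡-Reasoning
  open ℕSolver.+-*-Solver

*-next-odd : ∀ s n → s * (1 ℕ.+ 2 * suc n) ≡ s * (1 ℕ.+ 2 * n) ℕ.+ 2 * s
*-next-odd = solve 2 (λ s n →
  s :* (con 1 :+ con 2 :* (con 1 :+ n)) := s :* (con 1 :+ con 2 :* n) :+ con 2 :* s) refl
  where open ℕSolver.+-*-Solver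

-- Ring solver with integer coefficients

module IntegerCoefficients {c ℓ} (𝓡 : CommutativeRing c ℓ) where
  open CommutativeRing 𝓡 renaming (_*_ to _∙_; refl to ≈-refl; sym to ≈-sym; trans to ≈-trans; reflexive to ≈-reflexive)
  open Algebra.Properties.Ring ring using (-0#≈0#; -‿distribˡ-*; -‿distribʳ-*; -‿involutive)
  open Algebra.Properties.AbelianGroup +-abelianGroup using (⁻¹-∙-comm)
  open Algebra.Properties.Semiring.Mult.TCOptimised semiring using (1+×; ×-homo-+; ×1-homo-*)
    renaming (_×_ to _×′_)
  open Relation.Binary.Reasoning.Setoid setoid

  ι : ℤ → Carrier
  ι (+ n)    = n ×′ 1#
  ι -[1+ n ] = - (suc n ×′ 1#)

  ι-⊖ : ∀ m n → ι (m ℤ.⊖ n) ≈ m ×′ 1# - n ×′ 1#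
  ι-⊖ m       zero    = ≈-sym (≈-trans (+-congˡ -0#≈0#) (+-identityʳ _))
  ι-⊖ zero    (suc n) = ≈-sym (+-identityˡ _)
  ι-⊖ (suc m) (suc n) = begin
    ι (suc m ℤ.⊖ suc n)                     ≡⟨ cong ι (ℤₚ.[1+m]⊖[1+n]≡m⊖n m n) ⟩
    ι (m ℤ.⊖ n)                             ≈⟨ ι-⊖ m n ⟩
    m ×′ 1# - n ×′ 1#                       ≈⟨ +-congʳ (+-identityʳ _) ⟨
    m ×′ 1# + 0# - n ×′ 1#                  ≈⟨ +-congʳ (+-congˡ (-‿inverseʳ 1#)) ⟨
    m ×′ 1# + (1# - 1#) - n ×′ 1#           ≈⟨ +-congʳ (+-assoc _ _ _) ⟨
    m ×′ 1# + 1# - 1# - n ×′ 1#             ≈⟨ +-assoc _ _ _ ⟩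
    m ×′ 1# + 1# + (- 1# - n ×′ 1#)         ≈⟨ +-cong (+-comm _ _) (⁻¹-∙-comm _ _) ⟩
    1# + m ×′ 1# - (1# + n ×′ 1#)           ≈⟨ +-cong (1+× m 1#) (-‿cong (1+× n 1#)) ⟨
    suc m ×′ 1# - suc n ×′ 1#               ∎

  ι-+ : ∀ i j → ι (i ℤ.+ j) ≈ ι i + ι j
  ι-+ (+ m)    (+ n)    = ×-homo-+ 1# m n
  ι-+ (+ m)    -[1+ n ] = ι-⊖ m (suc n)
  ι-+ -[1+ m ] (+ n)    = ≈-trans (ι-⊖ n (suc m)) (+-comm _ _)
  ι-+ -[1+ m ] -[1+ n ] = begin
    - (suc (suc (m ℕ.+ n)) ×′ 1#)     ≡⟨ cong (λ k → - (suc k ×′ 1#)) (ℕₚ.+-suc m n) ⟨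
    - ((suc m ℕ.+ suc n) ×′ 1#)       ≈⟨ -‿cong (×-homo-+ 1# (suc m) (suc n)) ⟩
    - (suc m ×′ 1# + suc n ×′ 1#)     ≈⟨ ⁻¹-∙-comm _ _ ⟨
    - (suc m ×′ 1#) - (suc n ×′ 1#)   ∎

  ι-neg : ∀ i → ι (ℤ.- i) ≈ - ι i
  ι-neg (+ zero)  = ≈-sym -0#≈0#
  ι-neg (+ suc n) = ≈-refl
  ι-neg -[1+ n ]  = ≈-sym (-‿involutive _)

  ι-*-pos : ∀ m j → ι (+ m ℤ.* j) ≈ ι (+ m) ∙ ι j
  ι-*-pos m (+ n)    = ≈-trans (≈-reflexive (cong ι (sym (ℤₚ.pos-* m n)))) (×1-homo-* m n)
  ι-*-pos m -[1+ n ] = begin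
    ι (+ m ℤ.* -[1+ n ])        ≡⟨ cong ι (ℤₚ.neg-distribʳ-* (+ m) (+ suc n)) ⟨
    ι (ℤ.- (+ m ℤ.* + suc n))   ≈⟨ ι-neg (+ m ℤ.* + suc n) ⟩
    - ι (+ m ℤ.* + suc n)       ≈⟨ -‿cong (ι-*-pos m (+ suc n)) ⟩
    - (ι (+ m) ∙ ι (+ suc n))   ≈⟨ -‿distribʳ-* _ _ ⟩
    ι (+ m) ∙ ι -[1+ n ]        ∎

  ι-* : ∀ i j → ι (i ℤ.* j) ≈ ι i ∙ ι j
  ι-* (+ m)    j = ι-*-pos m j
  ι-* -[1+ m ] j = begin
    ι (-[1+ m ] ℤ.* j)          ≡⟨ cong ι (ℤₚ.neg-distribˡ-* (+ suc m) j) ⟨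
    ι (ℤ.- (+ suc m ℤ.* j))     ≈⟨ ι-neg (+ suc m ℤ.* j) ⟩
    - ι (+ suc m ℤ.* j)         ≈⟨ -‿cong (ι-*-pos (suc m) j) ⟩
    - (ι (+ suc m) ∙ ι j)       ≈⟨ -‿distribˡ-* _ _ ⟩
    ι -[1+ m ] ∙ ι j            ∎

  ι-homo : CommutativeRing.rawRing ℤₚ.+-*-commutativeRing -Raw-AlmostCommutative⟶ fromCommutativeRing 𝓡
  ι-homo = record
    { ⟦_⟧ = ι ; +-homo = ι-+ ; *-homo = ι-* ; -‿homo = ι-neg ; 0-homo = ≈-refl ; 1-homo = ≈-refl }

  -- Cancellations such as 1 - 1 = 0 in normal forms require a test for equal coefficients. Integers
  -- provide one, while equality in the ring itself need not be decidable.
  module Solver = Algebra.Solver.Ring _ _ ι-homo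
    (λ i j → Maybe.map (≈-reflexive ∘ cong ι) (dec⇒maybe (i ℤ.≟ j)))

-- Reciprocals, finite sums and Cauchy products

module QIdentities {c ℓ} (𝓡 : CommutativeRing c ℓ) where
  open CommutativeRing 𝓡 renaming (_*_ to _∙_; refl to ≈-refl; sym to ≈-sym; trans to ≈-trans; reflexive to ≈-reflexive)
  open IntegerCoefficients 𝓡 using (module Solver)
  open Solver
  open Relation.Binary.Reasoning.Setoid setoid

  𝟏 : ∀ {n} → Polynomial n
  𝟏 = con 1ℤ

  -- Turns the recurrence `b ≈ t ∙ a` of a Pochhammer symbol into one for its reciprocal, with no
  -- inverse of the new factor t in sight.
  recip-step : ∀ {a a⁻¹ b b⁻¹ t} → b ≈ t ∙ a → a ∙ a⁻¹ ≈ 1# → b ∙ b⁻¹ ≈ 1# → t ∙ b⁻¹ ≈ a⁻¹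
  recip-step {a} {a⁻¹} {b} {b⁻¹} {t} b≈ aa⁻¹ bb⁻¹ = begin
    t ∙ b⁻¹                ≈⟨ *-identityʳ _ ⟨
    t ∙ b⁻¹ ∙ 1#           ≈⟨ *-congˡ aa⁻¹ ⟨
    t ∙ b⁻¹ ∙ (a ∙ a⁻¹)    ≈⟨ solve 4 (λ t b a a′ → t :* b :* (a :* a′) := (t :* a) :* b :* a′) ≈-refl t b⁻¹ a a⁻¹ ⟩
    t ∙ a ∙ b⁻¹ ∙ a⁻¹      ≈⟨ *-congʳ (*-congʳ b≈) ⟨
    b ∙ b⁻¹ ∙ a⁻¹          ≈⟨ *-congʳ bb⁻¹ ⟩
    1# ∙ a⁻¹               ≈⟨ *-identityˡ _ ⟩
    a⁻¹                    ∎

  -- Stands in for a proof that `recip` respects congruence: inverses of congruent elements are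
  -- congruent, however they were computed.
  recip-unique : ∀ {a b a⁻¹ b⁻¹} → a ≈ b → a ∙ a⁻¹ ≈ 1# → b ∙ b⁻¹ ≈ 1# → a⁻¹ ≈ b⁻¹
  recip-unique a≈b aa⁻¹ bb⁻¹ =
    ≈-sym (≈-trans (≈-sym (*-identityˡ _)) (recip-step (≈-trans (≈-sym a≈b) (≈-sym (*-identityˡ _))) aa⁻¹ bb⁻¹))

  *-cancelˡ-unit : ∀ {t t⁻¹ x y} → t ∙ t⁻¹ ≈ 1# → t ∙ x ≈ t ∙ y → x ≈ y
  *-cancelˡ-unit {t} {t⁻¹} {x} {y} tt⁻¹ tx≈ty = begin
    x               ≈⟨ *-identityˡ x ⟨
    1# ∙ x          ≈⟨ *-congʳ tt⁻¹ ⟨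
    t ∙ t⁻¹ ∙ x     ≈⟨ lemma x ⟩
    t⁻¹ ∙ (t ∙ x)   ≈⟨ *-congˡ tx≈ty ⟩
    t⁻¹ ∙ (t ∙ y)   ≈⟨ lemma y ⟨
    t ∙ t⁻¹ ∙ y     ≈⟨ *-congʳ tt⁻¹ ⟩
    1# ∙ y          ≈⟨ *-identityˡ y ⟩
    y               ∎
    where
    lemma : ∀ z → t ∙ t⁻¹ ∙ z ≈ t⁻¹ ∙ (t ∙ z)
    lemma z = solve 3 (λ a b c → a :* b :* c := b :* (a :* c)) ≈-refl t t⁻¹ z

  ∑ : ℕ → (ℕ → Carrier) → Carrier
  ∑ zero    f = 0#
  ∑ (suc n) f = f 0 + ∑ n (f ∘ suc)

  ∑-cong : ∀ n {f g} → (∀ i → f i ≈ g i) → ∑ n f ≈ ∑ n g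
  ∑-cong zero    f≈g = ≈-refl
  ∑-cong (suc n) f≈g = +-cong (f≈g 0) (∑-cong n (f≈g ∘ suc))

  ∑-snoc : ∀ n f → ∑ (suc n) f ≈ ∑ n f + f n
  ∑-snoc zero    f = +-comm _ _
  ∑-snoc (suc n) f = ≈-trans (+-congˡ (∑-snoc n (f ∘ suc))) (≈-sym (+-assoc _ _ _))

  ∑-zero : ∀ n {f} → (∀ i → f i ≈ 0#) → ∑ n f ≈ 0#
  ∑-zero zero    f≈0 = ≈-refl
  ∑-zero (suc n) f≈0 = ≈-trans (+-cong (f≈0 0) (∑-zero n (f≈0 ∘ suc))) (+-identityˡ 0#)

  ∑-+ : ∀ n f g → ∑ n (λ i → f i + g i) ≈ ∑ n f + ∑ n g
  ∑-+ zero    f g = ≈-sym (+-identityˡ 0#)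
  ∑-+ (suc n) f g = ≈-trans (+-congˡ (∑-+ n (f ∘ suc) (g ∘ suc)))
    (solve 4 (λ a b c d → a :+ b :+ (c :+ d) := a :+ c :+ (b :+ d)) ≈-refl (f 0) (g 0) _ _)

  ∑-* : ∀ n x f → ∑ n (λ i → x ∙ f i) ≈ x ∙ ∑ n f
  ∑-* zero    x f = ≈-sym (zeroʳ x)
  ∑-* (suc n) x f = ≈-trans (+-congˡ (∑-* n x (f ∘ suc))) (≈-sym (distribˡ x _ _))

  ∏ : ℕ → (ℕ → Carrier) → Carrier
  ∏ zero    f = 1#
  ∏ (suc n) f = f n ∙ ∏ n f

  -- The antidiagonal sum over k + j = n. Recursion in place of the index n - j lets the term j = 0
  -- split off by definition and the term k = 0 by `diag-sucˡ`, so that either index can be shifted.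
  diag : (ℕ → ℕ → Carrier) → ℕ → Carrier
  diag F zero    = F 0 0
  diag F (suc n) = F (suc n) 0 + diag (λ k j → F k (suc j)) n

  diag-sucˡ : ∀ F n → diag F (suc n) ≈ F 0 (suc n) + diag (λ k j → F (suc k) j) n
  diag-sucˡ F zero    = +-comm _ _
  diag-sucˡ F (suc n) = ≈-trans (+-congˡ (diag-sucˡ (λ k j → F k (suc j)) n))
    (solve 3 (λ a b c → a :+ (b :+ c) := b :+ (a :+ c)) ≈-refl (F (suc (suc n)) 0) _ _)

  diag-cong : ∀ n {F G} → (∀ k j → k ℕ.+ j ≡ n → F k j ≈ G k j) → diag F n ≈ diag G n
  diag-cong zero    F≈G = F≈G 0 0 refl
  diag-cong (suc n) F≈G = +-cong (F≈G (suc n) 0 (ℕₚ.+-identityʳ _))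
    (diag-cong n λ k j eq → F≈G k (suc j) (trans (ℕₚ.+-suc k j) (cong suc eq)))

  diag-+ : ∀ n F G → diag (λ k j → F k j + G k j) n ≈ diag F n + diag G n
  diag-+ zero    F G = ≈-refl
  diag-+ (suc n) F G = ≈-trans (+-congˡ (diag-+ n (λ k j → F k (suc j)) (λ k j → G k (suc j))))
    (solve 4 (λ a b c d → a :+ b :+ (c :+ d) := a :+ c :+ (b :+ d)) ≈-refl (F (suc n) 0) (G (suc n) 0) _ _)

  diag-* : ∀ n x F → diag (λ k j → x ∙ F k j) n ≈ x ∙ diag F n
  diag-* zero    x F = ≈-refl
  diag-* (suc n) x F = ≈-trans (+-congˡ (diag-* n x (λ k j → F k (suc j)))) (≈-sym (distribˡ x _ _))

  diag-zero : ∀ n {F} → (∀ k j → F k j ≈ 0#) → diag F n ≈ 0#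
  diag-zero zero    F≈0 = F≈0 0 0
  diag-zero (suc n) F≈0 = ≈-trans (+-cong (F≈0 (suc n) 0) (diag-zero n λ k j → F≈0 k (suc j))) (+-identityˡ 0#)

  -- Weights encode dilations: if a and b are the coefficients of two series in x, the weight q^k
  -- replaces x by qx in the first series, and q^{vj} replaces x by q^v x in the second.
  module Weighted (a b : ℕ → Carrier) where

    opaque
      weighted : (ℕ → ℕ → Carrier) → ℕ → Carrier
      weighted w = diag λ k j → w k j ∙ (a k ∙ b j)

    conv : ℕ → Carrier
    conv = weighted λ _ _ → 1#

    opaque
      unfolding weighted

      conv≈diag : ∀ n → conv n ≈ diag (λ k j → a k ∙ b j) n
      conv≈diag n = diag-cong n λ _ _ _ → *-identityˡ _

      weighted-0 : ∀ w → weighted w 0 ≈ w 0 0 ∙ (a 0 ∙ b 0)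
      weighted-0 w = ≈-refl

      weighted-cong : ∀ n {w w′} → (∀ k j → k ℕ.+ j ≡ n → w k j ≈ w′ k j) → weighted w n ≈ weighted w′ n
      weighted-cong n w≈ = diag-cong n λ k j eq → *-congʳ (w≈ k j eq)

      weighted-+ : ∀ n (w w′ : ℕ → ℕ → Carrier) →
                   weighted (λ k j → w k j + w′ k j) n ≈ weighted w n + weighted w′ n
      weighted-+ n w w′ = ≈-trans (diag-cong n λ _ _ _ → distribʳ _ _ _) (diag-+ n _ _)

      weighted-const : ∀ n x → weighted (λ _ _ → x) n ≈ x ∙ conv n
      weighted-const n x = ≈-trans
        (diag-cong n λ k j _ → solve 3 (λ x y z → x :* (y :* z) := x :* (𝟏 :* (y :* z))) ≈-refl x (a k) (b j))
        (diag-* n x _)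

      weighted-- : ∀ n (w w′ : ℕ → ℕ → Carrier) →
                   weighted (λ k j → w k j - w′ k j) n ≈ weighted w n - weighted w′ n
      weighted-- n w w′ = begin
        diag (λ k j → (w k j - w′ k j) ∙ (a k ∙ b j)) n
          ≈⟨ (diag-cong n λ k j _ → solve 3 (λ x y z → (x :- y) :* z := x :* z :+ :- 𝟏 :* (y :* z)) ≈-refl (w k j) (w′ k j) (a k ∙ b j)) ⟩
        diag (λ k j → w k j ∙ (a k ∙ b j) + - 1# ∙ (w′ k j ∙ (a k ∙ b j))) n
          ≈⟨ ≈-trans (diag-+ n _ _) (+-congˡ (diag-* n _ _)) ⟩
        diag (λ k j → w k j ∙ (a k ∙ b j)) n + - 1# ∙ diag (λ k j → w′ k j ∙ (a k ∙ b j)) n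
          ≈⟨ solve 2 (λ x y → x :+ :- 𝟏 :* y := x :- y) ≈-refl _ _ ⟩
        diag (λ k j → w k j ∙ (a k ∙ b j)) n - diag (λ k j → w′ k j ∙ (a k ∙ b j)) n ∎

      weighted-zero : ∀ n {w} → (∀ k j → w k j ≈ 0#) → weighted w n ≈ 0#
      weighted-zero n w≈0 = diag-zero n λ k j → ≈-trans (*-congʳ (w≈0 k j)) (zeroˡ _)

  -- With X k = q^k and Y j = q^{vj}, a k = 1/(q;q)_k and
  -- b j = (-1)^j q^{v j(j-1)/2 + j}/(q^v;q^v)_j are the coefficients of
  -- 1/(x;q)_∞ and (xq;q^v)_∞, and conv below those of their product.
  module Convolution
    (q : Carrier) (X Y a b : ℕ → Carrier)
    (X-zero : X 0 ≈ 1#) (X-suc : ∀ k → X (suc k) ≈ q ∙ X k) (Y-zero : Y 0 ≈ 1#)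
    (a-step : ∀ k → (1# - X (suc k)) ∙ a (suc k) ≈ a k)
    (b-step : ∀ j → (1# - Y (suc j)) ∙ b (suc j) ≈ - (q ∙ Y j ∙ b j))
    where

    open Weighted a b public

    opaque
      unfolding weighted

      -- The coefficient form of F(x) - F(qx) = x F(x) for F = 1/(x;q)_∞: the term k = 0 dies
      -- because 1 - q^0 = 0, and elsewhere `a-step` lowers k.
      shift-a : ∀ (w : ℕ → ℕ → Carrier) n →
                weighted (λ k j → w k j ∙ (1# - X k)) (suc n) ≈ weighted (λ k j → w (suc k) j) n
      shift-a w n = begin
        diag (λ k j → w k j ∙ (1# - X k) ∙ (a k ∙ b j)) (suc n)
          ≈⟨ diag-sucˡ (λ k j → w k j ∙ (1# - X k) ∙ (a k ∙ b j)) n ⟩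
        w 0 (suc n) ∙ (1# - X 0) ∙ (a 0 ∙ b (suc n)) +
        diag (λ k j → w (suc k) j ∙ (1# - X (suc k)) ∙ (a (suc k) ∙ b j)) n
          ≈⟨ +-cong (*-congʳ (*-congˡ (+-congˡ (-‿cong X-zero)))) (diag-cong n λ k j _ → ≈-trans
               (solve 4 (λ w x a b → w :* x :* (a :* b) := w :* (x :* a :* b)) ≈-refl
                 (w (suc k) j) (1# - X (suc k)) (a (suc k)) (b j))
               (*-congˡ (*-congʳ (a-step k)))) ⟩
        w 0 (suc n) ∙ (1# - 1#) ∙ (a 0 ∙ b (suc n)) + diag (λ k j → w (suc k) j ∙ (a k ∙ b j)) n
          ≈⟨ solve 3 (λ w x y → w :* (𝟏 :- 𝟏) :* x :+ y := y) ≈-refl (w 0 (suc n)) (a 0 ∙ b (suc n)) _ ⟩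
        diag (λ k j → w (suc k) j ∙ (a k ∙ b j)) n ∎

      -- Likewise G(x) - G(q^v x) = -qx G(q^v x) for G = (xq;q^v)_∞.
      shift-b : ∀ (w : ℕ → ℕ → Carrier) n →
                weighted (λ k j → w k j ∙ (1# - Y j)) (suc n) ≈ weighted (λ k j → - (w k (suc j) ∙ (q ∙ Y j))) n
      shift-b w n = begin
        diag (λ k j → w k j ∙ (1# - Y j) ∙ (a k ∙ b j)) (suc n)
          ≈⟨ +-cong (*-congʳ (*-congˡ (+-congˡ (-‿cong Y-zero)))) (diag-cong n λ k j _ → begin
               w k (suc j) ∙ (1# - Y (suc j)) ∙ (a k ∙ b (suc j))
                 ≈⟨ solve 4 (λ w x a b → w :* x :* (a :* b) := w :* (x :* b) :* a) ≈-refl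
                      (w k (suc j)) (1# - Y (suc j)) (a k) (b (suc j)) ⟩
               w k (suc j) ∙ ((1# - Y (suc j)) ∙ b (suc j)) ∙ a k
                 ≈⟨ *-congʳ (*-congˡ (b-step j)) ⟩
               w k (suc j) ∙ (- (q ∙ Y j ∙ b j)) ∙ a k
                 ≈⟨ solve 4 (λ w x b a → w :* (:- (x :* b)) :* a := :- (w :* x) :* (a :* b)) ≈-refl
                      (w k (suc j)) (q ∙ Y j) (b j) (a k) ⟩
               - (w k (suc j) ∙ (q ∙ Y j)) ∙ (a k ∙ b j) ∎) ⟩
        w (suc n) 0 ∙ (1# - 1#) ∙ (a (suc n) ∙ b 0) + diag (λ k j → - (w k (suc j) ∙ (q ∙ Y j)) ∙ (a k ∙ b j)) n
          ≈⟨ solve 3 (λ w x y → w :* (𝟏 :- 𝟏) :* x :+ y := y) ≈-refl (w (suc n) 0) (a (suc n) ∙ b 0) _ ⟩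
        diag (λ k j → - (w k (suc j) ∙ (q ∙ Y j)) ∙ (a k ∙ b j)) n ∎

    -- The contributions of (1 - q^{vj}) b_j and (1 - q^k) a_k cancel after
    -- the shifts j ↦ j + 1 and k ↦ k + 1.
    weighted-vanishes : ∀ n → weighted (λ k j → (1# - Y j) + q ∙ Y j ∙ (1# - X k)) n ≈ 0#
    weighted-vanishes zero    = begin
      weighted (λ k j → (1# - Y j) + q ∙ Y j ∙ (1# - X k)) 0
        ≈⟨ weighted-0 _ ⟩
      ((1# - Y 0) + q ∙ Y 0 ∙ (1# - X 0)) ∙ (a 0 ∙ b 0)
        ≈⟨ *-congʳ (+-cong (+-congˡ (-‿cong Y-zero)) (*-congˡ (+-congˡ (-‿cong X-zero)))) ⟩
      ((1# - 1#) + q ∙ Y 0 ∙ (1# - 1#)) ∙ (a 0 ∙ b 0)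
        ≈⟨ solve 2 (λ x y → ((𝟏 :- 𝟏) :+ x :* (𝟏 :- 𝟏)) :* y := con 0ℤ) ≈-refl _ _ ⟩
      0# ∎
    weighted-vanishes (suc n) = begin
      weighted (λ k j → (1# - Y j) + q ∙ Y j ∙ (1# - X k)) (suc n)
        -- The factor 1 brings the weight into the form w (1 - Y j) that `shift-b` acts on.
        ≈⟨ weighted-cong (suc n) (λ _ _ _ → +-congʳ (≈-sym (*-identityˡ _))) ⟩
      weighted (λ k j → 1# ∙ (1# - Y j) + q ∙ Y j ∙ (1# - X k)) (suc n)
        ≈⟨ weighted-+ (suc n) _ _ ⟩
      weighted (λ k j → 1# ∙ (1# - Y j)) (suc n) + weighted (λ k j → q ∙ Y j ∙ (1# - X k)) (suc n)
        ≈⟨ +-cong (shift-b (λ _ _ → 1#) n) (shift-a (λ _ j → q ∙ Y j) n) ⟩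
      weighted (λ k j → - (1# ∙ (q ∙ Y j))) n + weighted (λ k j → q ∙ Y j) n
        ≈⟨ weighted-+ n _ _ ⟨
      weighted (λ k j → - (1# ∙ (q ∙ Y j)) + q ∙ Y j) n
        ≈⟨ weighted-zero n (λ k j → solve 1 (λ x → :- (𝟏 :* x) :+ x := con 0ℤ) ≈-refl _) ⟩
      0# ∎

    -- This is (1-x)H(x) = (1-qx)H(qx) for the product H. The factor 1 - q^{n+1} stays on both
    -- sides, since in a general ring it need not be cancellable.
    conv-recurrence-v=1 : (∀ j → Y j ≈ X j) → (∀ k j → X (k ℕ.+ j) ≈ X k ∙ X j) →
      ∀ n → (1# - X (suc n)) ∙ conv (suc n) ≈ (1# - X (suc n)) ∙ conv n
    conv-recurrence-v=1 Y≈X X-+ n = begin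
      (1# - X (suc n)) ∙ conv (suc n)
        ≈⟨ weighted-const (suc n) _ ⟨
      weighted (λ _ _ → 1# - X (suc n)) (suc n)
        ≈⟨ weighted-cong (suc n) (λ k j eq → begin
             1# - X (suc n)                        ≡⟨ cong (λ i → 1# - X i) (sym eq) ⟩
             1# - X (k ℕ.+ j)                      ≈⟨ +-congˡ (-‿cong (≈-trans (X-+ k j) (*-congˡ (≈-sym (Y≈X j))))) ⟩
             1# - X k ∙ Y j                        ≈⟨ solve 2 (λ x y → 𝟏 :- x :* y := 𝟏 :* (𝟏 :- y) :+ y :* (𝟏 :- x)) ≈-refl _ _ ⟩
             1# ∙ (1# - Y j) + Y j ∙ (1# - X k)    ∎) ⟩
      weighted (λ k j → 1# ∙ (1# - Y j) + Y j ∙ (1# - X k)) (suc n)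
        ≈⟨ ≈-trans (weighted-+ (suc n) _ _) (+-cong (shift-b (λ _ _ → 1#) n) (shift-a (λ _ j → Y j) n)) ⟩
      weighted (λ k j → - (1# ∙ (q ∙ Y j))) n + weighted (λ k j → Y j) n
        ≈⟨ weighted-+ n _ _ ⟨
      weighted (λ k j → - (1# ∙ (q ∙ Y j)) + Y j) n
        ≈⟨ weighted-cong n (λ k j eq → begin
             - (1# ∙ (q ∙ Y j)) + Y j
               -- Splitting off the weight of `weighted-vanishes`, whose sum is zero, leaves a
               -- weight that depends on k + j only.
               ≈⟨ solve 3 (λ q x y → :- (𝟏 :* (q :* y)) :+ y :=
                    (𝟏 :- q :* (x :* y)) :- ((𝟏 :- y) :+ q :* y :* (𝟏 :- x))) ≈-refl q (X k) (Y j) ⟩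
             (1# - q ∙ (X k ∙ Y j)) - ((1# - Y j) + q ∙ Y j ∙ (1# - X k))
               ≈⟨ +-congʳ (+-congˡ (-‿cong (*-congˡ (≈-trans (*-congˡ (Y≈X j)) (≈-sym (X-+ k j)))))) ⟩
             (1# - q ∙ X (k ℕ.+ j)) - ((1# - Y j) + q ∙ Y j ∙ (1# - X k))
               ≈⟨ +-congʳ (+-congˡ (-‿cong (≈-trans (*-congˡ (≈-reflexive (cong X eq))) (≈-sym (X-suc n))))) ⟩
             (1# - X (suc n)) - ((1# - Y j) + q ∙ Y j ∙ (1# - X k)) ∎) ⟩
      weighted (λ k j → (1# - X (suc n)) - ((1# - Y j) + q ∙ Y j ∙ (1# - X k))) n
        ≈⟨ weighted-- n _ _ ⟩
      weighted (λ _ _ → 1# - X (suc n)) n - weighted (λ k j → (1# - Y j) + q ∙ Y j ∙ (1# - X k)) n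
        ≈⟨ +-cong (weighted-const n _) (-‿cong (weighted-vanishes n)) ⟩
      (1# - X (suc n)) ∙ conv n - 0#
        ≈⟨ solve 1 (λ x → x :- con 0ℤ := x) ≈-refl _ ⟩
      (1# - X (suc n)) ∙ conv n ∎

    -- This is (1-x)H(x) = H(q²x). As q^{2(k+j)} is the square of q^k times q^{2j}, the
    -- factorisation 1 - q^{2k} = (1 + q^k)(1 - q^k) makes `shift-a` applicable.
    conv-recurrence-v=2 : (∀ k j → Y (k ℕ.+ j) ≈ X k ∙ X k ∙ Y j) →
      ∀ n → (1# - Y (suc n)) ∙ conv (suc n) ≈ conv n
    conv-recurrence-v=2 Y-+ n = begin
      (1# - Y (suc n)) ∙ conv (suc n)
        ≈⟨ weighted-const (suc n) _ ⟨
      weighted (λ _ _ → 1# - Y (suc n)) (suc n)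
        ≈⟨ weighted-cong (suc n) (λ k j eq → begin
             1# - Y (suc n)             ≡⟨ cong (λ i → 1# - Y i) (sym eq) ⟩
             1# - Y (k ℕ.+ j)           ≈⟨ +-congˡ (-‿cong (Y-+ k j)) ⟩
             1# - X k ∙ X k ∙ Y j       ≈⟨ solve 2 (λ x y → 𝟏 :- x :* x :* y :=
                                             𝟏 :* (𝟏 :- y) :+ y :* (𝟏 :+ x) :* (𝟏 :- x)) ≈-refl _ _ ⟩
             1# ∙ (1# - Y j) + Y j ∙ (1# + X k) ∙ (1# - X k) ∎) ⟩
      weighted (λ k j → 1# ∙ (1# - Y j) + Y j ∙ (1# + X k) ∙ (1# - X k)) (suc n)
        ≈⟨ ≈-trans (weighted-+ (suc n) _ _)
             (+-cong (shift-b (λ _ _ → 1#) n) (shift-a (λ k j → Y j ∙ (1# + X k)) n)) ⟩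
      weighted (λ k j → - (1# ∙ (q ∙ Y j))) n + weighted (λ k j → Y j ∙ (1# + X (suc k))) n
        ≈⟨ weighted-+ n _ _ ⟨
      weighted (λ k j → - (1# ∙ (q ∙ Y j)) + Y j ∙ (1# + X (suc k))) n
        ≈⟨ weighted-cong n (λ k j _ → ≈-trans (+-congˡ (*-congˡ (+-congˡ (X-suc k))))
             (solve 3 (λ q x y → :- (𝟏 :* (q :* y)) :+ y :* (𝟏 :+ q :* x) :=
                𝟏 :- ((𝟏 :- y) :+ q :* y :* (𝟏 :- x))) ≈-refl q (X k) (Y j))) ⟩
      weighted (λ k j → 1# - ((1# - Y j) + q ∙ Y j ∙ (1# - X k))) n
        ≈⟨ weighted-- n _ _ ⟩
      conv n - weighted (λ k j → (1# - Y j) + q ∙ Y j ∙ (1# - X k)) n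
        ≈⟨ +-congˡ (-‿cong (weighted-vanishes n)) ⟩
      conv n - 0#
        ≈⟨ solve 1 (λ x → x :- con 0ℤ := x) ≈-refl _ ⟩
      conv n ∎

  -- Y n = p^n, W i n = p^{in}, E n = z^n p^{n(n-1)/2} and c n = 1/(p;p)_n.
  module Euler
    (z : Carrier) (Y E c : ℕ → Carrier) (W : ℕ → ℕ → Carrier)
    (E-zero : E 0 ≈ 1#) (E-suc : ∀ n → E (suc n) ≈ z ∙ Y n ∙ E n)
    (c-zero : c 0 ≈ 1#) (c-step : ∀ n → (1# - Y (suc n)) ∙ c (suc n) ≈ c n)
    (W-0ˡ : ∀ n → W 0 n ≈ 1#) (W-0ʳ : ∀ i → W i 0 ≈ 1#)
    (W-sucˡ : ∀ i n → W (suc i) n ≈ Y n ∙ W i n) (W-sucʳ : ∀ i n → W i (suc n) ≈ Y i ∙ W i n)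
    where

    -- The summand of Euler's series with z replaced by z p^i, so that raising i dilates z by p.
    term : ℕ → ℕ → Carrier
    term i n = E n ∙ W i n ∙ c n

    term-zero : ∀ i → term i 0 ≈ 1#
    term-zero i = ≈-trans (*-cong (*-cong E-zero (W-0ʳ i)) c-zero)
      (≈-trans (*-identityʳ _) (*-identityʳ _))

    -- Write 1 = y + (1 - y) with y = p^{n+1}: the part y raises i, and the part 1 - y is absorbed
    -- by `c-step`, which lowers n.
    term-suc : ∀ i n → term i (suc n) ≈ term (suc i) (suc n) + z ∙ Y i ∙ term (suc i) n
    term-suc i n = begin
      E (suc n) ∙ W i (suc n) ∙ c (suc n)
        ≈⟨ solve 4 (λ e w c y → e :* w :* c := e :* (y :* w) :* c :+ e :* w :* ((𝟏 :- y) :* c)) ≈-refl _ _ _ (Y (suc n)) ⟩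
      E (suc n) ∙ (Y (suc n) ∙ W i (suc n)) ∙ c (suc n) + E (suc n) ∙ W i (suc n) ∙ ((1# - Y (suc n)) ∙ c (suc n))
        ≈⟨ +-cong (*-congʳ (*-congˡ (≈-sym (W-sucˡ i (suc n))))) (*-cong (*-cong (E-suc n) (W-sucʳ i n)) (c-step n)) ⟩
      term (suc i) (suc n) + z ∙ Y n ∙ E n ∙ (Y i ∙ W i n) ∙ c n
        ≈⟨ +-congˡ (solve 6 (λ z y e x w c → z :* y :* e :* (x :* w) :* c := z :* x :* (e :* (y :* w) :* c)) ≈-refl
             z (Y n) (E n) (Y i) (W i n) (c n)) ⟩
      term (suc i) (suc n) + z ∙ Y i ∙ (E n ∙ (Y n ∙ W i n) ∙ c n)
        ≈⟨ +-congˡ (*-congˡ (*-congʳ (*-congˡ (W-sucˡ i n)))) ⟨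
      term (suc i) (suc n) + z ∙ Y i ∙ term (suc i) n ∎

    module _ {K} (E-vanishes : E K ≈ 0#) where

      -- The functional equation f(z) = (1 + z) f(pz) of Euler's series. Shifting n shortens one of
      -- the two sums by its last term, which is zero because `E K` is.
      ∑-term-step : ∀ i → ∑ (suc K) (term i) ≈ (1# + z ∙ Y i) ∙ ∑ (suc K) (term (suc i))
      ∑-term-step i = begin
        term i 0 + ∑ K (term i ∘ suc)
          ≈⟨ +-cong (≈-trans (term-zero i) (≈-sym (term-zero (suc i))))
                    (≈-trans (∑-cong K (term-suc i)) (≈-trans (∑-+ K _ _) (+-congˡ (∑-* K _ _)))) ⟩
        term (suc i) 0 + (∑ K (term (suc i) ∘ suc) + z ∙ Y i ∙ ∑ K (term (suc i)))
          ≈⟨ +-assoc _ _ _ ⟨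
        ∑ (suc K) (term (suc i)) + z ∙ Y i ∙ ∑ K (term (suc i))
          ≈⟨ +-congˡ (*-congˡ (begin
               ∑ K (term (suc i))                      ≈⟨ +-identityʳ _ ⟨
               ∑ K (term (suc i)) + 0#                 ≈⟨ +-congˡ (≈-trans (*-congʳ (≈-trans (*-congʳ E-vanishes) (zeroˡ _))) (zeroˡ _)) ⟨
               ∑ K (term (suc i)) + term (suc i) K     ≈⟨ ∑-snoc K _ ⟨
               ∑ (suc K) (term (suc i))                ∎)) ⟩
        ∑ (suc K) (term (suc i)) + z ∙ Y i ∙ ∑ (suc K) (term (suc i))
          ≈⟨ solve 2 (λ s x → s :+ x :* s := (𝟏 :+ x) :* s) ≈-refl _ _ ⟩
        (1# + z ∙ Y i) ∙ ∑ (suc K) (term (suc i)) ∎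

      ∑-term-product : ∀ i → ∑ (suc K) (term 0) ≈ ∏ i (λ k → 1# + z ∙ Y k) ∙ ∑ (suc K) (term i)
      ∑-term-product zero    = ≈-sym (*-identityˡ _)
      ∑-term-product (suc i) = ≈-trans (∑-term-product i) (≈-trans (*-congˡ (∑-term-step i))
        (solve 3 (λ x y z → x :* (y :* z) := y :* x :* z) ≈-refl _ _ _))

      euler : ∀ {i} → Y i ≈ 0# → ∑ (suc K) (λ n → E n ∙ c n) ≈ ∏ i (λ k → 1# + z ∙ Y k)
      euler {i} Yi≈0 = begin
        ∑ (suc K) (λ n → E n ∙ c n)
          ≈⟨ ∑-cong (suc K) (λ n → *-congʳ {c n} {E n ∙ W 0 n} {E n} (≈-trans (*-congˡ (W-0ˡ n)) (*-identityʳ _))) ⟨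
        ∑ (suc K) (term 0)
          ≈⟨ ∑-term-product i ⟩
        ∏ i (λ k → 1# + z ∙ Y k) ∙ (term i 0 + ∑ K (term i ∘ suc))
          -- Once p^i is zero, every summand but the first contains it as a factor.
          ≈⟨ *-congˡ (+-cong (term-zero i) (∑-zero K λ n →
               ≈-trans (*-congʳ (≈-trans (*-congˡ (≈-trans (W-sucʳ i n) (≈-trans (*-congʳ Yi≈0) (zeroˡ _)))) (zeroʳ _))) (zeroˡ _))) ⟩
        ∏ i (λ k → 1# + z ∙ Y k) ∙ (1# + 0#)
          ≈⟨ solve 1 (λ x → x :* (𝟏 :+ con 0ℤ) := x) ≈-refl _ ⟩
        ∏ i (λ k → 1# + z ∙ Y k) ∎

  -- Shanks' finite form of Gauss's identity.  Here X k = x^k,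
  -- P n = ∏_{1≤k≤n} (1-x^{2k})/(1-x^{2k-1}), and jump is the remainder by which
  -- ∑_{s<S} (P n / P s) x^{s(2n+1)} telescopes as n increases by 1.
  module Shanks
    (X A A⁻¹ B B⁻¹ : ℕ → Carrier)
    (X-zero : X 0 ≈ 1#) (X-+ : ∀ m n → X (m ℕ.+ n) ≈ X m ∙ X n)
    (A-zero : A 0 ≈ 1#) (A-suc : ∀ n → A (suc n) ≈ (1# - X (2 ℕ.+ 2 * n)) ∙ A n) (A-inv : ∀ n → A n ∙ A⁻¹ n ≈ 1#)
    (B-zero : B 0 ≈ 1#) (B-suc : ∀ n → B (suc n) ≈ (1# - X (1 ℕ.+ 2 * n)) ∙ B n) (B-inv : ∀ n → B n ∙ B⁻¹ n ≈ 1#)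
    where

    -- `U n` is 1/(1 - x^{2n+1}), written as a quotient of consecutive B's so that the given
    -- inverses suffice.
    P P⁻¹ U : ℕ → Carrier
    P n   = A n ∙ B⁻¹ n
    P⁻¹ n = B n ∙ A⁻¹ n
    U n   = B n ∙ B⁻¹ (suc n)

    P-inv : ∀ n → P n ∙ P⁻¹ n ≈ 1#
    P-inv n = begin
      A n ∙ B⁻¹ n ∙ (B n ∙ A⁻¹ n)
        ≈⟨ solve 4 (λ a b c d → a :* b :* (c :* d) := (a :* d) :* (c :* b)) ≈-refl (A n) (B⁻¹ n) (B n) (A⁻¹ n) ⟩
      A n ∙ A⁻¹ n ∙ (B n ∙ B⁻¹ n)
        ≈⟨ *-cong (A-inv n) (B-inv n) ⟩
      1# ∙ 1#
        ≈⟨ *-identityˡ 1# ⟩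
      1# ∎

    U-inv : ∀ n → U n ∙ (1# - X (1 ℕ.+ 2 * n)) ≈ 1#
    U-inv n = begin
      B n ∙ B⁻¹ (suc n) ∙ (1# - X (1 ℕ.+ 2 * n))
        ≈⟨ solve 3 (λ b c t → b :* c :* t := t :* b :* c) ≈-refl (B n) (B⁻¹ (suc n)) (1# - X (1 ℕ.+ 2 * n)) ⟩
      (1# - X (1 ℕ.+ 2 * n)) ∙ B n ∙ B⁻¹ (suc n)
        ≈⟨ *-congʳ (B-suc n) ⟨
      B (suc n) ∙ B⁻¹ (suc n)
        ≈⟨ B-inv (suc n) ⟩
      1# ∎

    P-suc : ∀ n → P (suc n) ≈ P n ∙ (1# - X (2 ℕ.+ 2 * n)) ∙ U n
    P-suc n = begin
      A (suc n) ∙ B⁻¹ (suc n)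
        ≈⟨ *-congʳ (A-suc n) ⟩
      (1# - X (2 ℕ.+ 2 * n)) ∙ A n ∙ B⁻¹ (suc n)
        ≈⟨ *-identityʳ _ ⟨
      (1# - X (2 ℕ.+ 2 * n)) ∙ A n ∙ B⁻¹ (suc n) ∙ 1#
        ≈⟨ *-congˡ (B-inv n) ⟨
      (1# - X (2 ℕ.+ 2 * n)) ∙ A n ∙ B⁻¹ (suc n) ∙ (B n ∙ B⁻¹ n)
        ≈⟨ solve 5 (λ t a b c d → t :* a :* b :* (c :* d) := a :* d :* t :* (c :* b)) ≈-refl
             (1# - X (2 ℕ.+ 2 * n)) (A n) (B⁻¹ (suc n)) (B n) (B⁻¹ n) ⟩
      P n ∙ (1# - X (2 ℕ.+ 2 * n)) ∙ U n ∎

    P⁻¹-suc : ∀ n → (1# - X (2 ℕ.+ 2 * n)) ∙ P⁻¹ (suc n) ≈ (1# - X (1 ℕ.+ 2 * n)) ∙ P⁻¹ n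
    P⁻¹-suc n = begin
      (1# - X (2 ℕ.+ 2 * n)) ∙ (B (suc n) ∙ A⁻¹ (suc n))
        ≈⟨ solve 3 (λ t b a → t :* (b :* a) := b :* (t :* a)) ≈-refl (1# - X (2 ℕ.+ 2 * n)) (B (suc n)) (A⁻¹ (suc n)) ⟩
      B (suc n) ∙ ((1# - X (2 ℕ.+ 2 * n)) ∙ A⁻¹ (suc n))
        ≈⟨ *-cong (B-suc n) (recip-step (A-suc n) (A-inv n) (A-inv (suc n))) ⟩
      (1# - X (1 ℕ.+ 2 * n)) ∙ B n ∙ A⁻¹ n
        ≈⟨ *-assoc _ _ _ ⟩
      (1# - X (1 ℕ.+ 2 * n)) ∙ P⁻¹ n ∎

    term : ℕ → ℕ → Carrier
    term n s = P n ∙ (P⁻¹ s ∙ X (s * (1 ℕ.+ 2 * n)))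

    jump : ℕ → ℕ → Carrier
    jump n s = P n ∙ U n ∙ (X (s * (1 ℕ.+ 2 * n)) ∙ ((1# - X (2 * s)) ∙ P⁻¹ s))

    jump-zero : ∀ n → jump n 0 ≈ 0#
    jump-zero n = ≈-trans (*-congˡ (*-congˡ (*-congʳ (+-congˡ (-‿cong X-zero)))))
      (solve 3 (λ x y z → x :* (y :* ((𝟏 :- 𝟏) :* z)) := con 0ℤ) ≈-refl (P n ∙ U n) (X 0) (P⁻¹ 0))

    -- Expresses the jump at s + 1 through `P⁻¹ s`, so that it can be compared with terms at s.
    jump-suc : ∀ n s → jump n (suc s) ≈
      P n ∙ U n ∙ (X (1 ℕ.+ 2 * n) ∙ X (s * (1 ℕ.+ 2 * n)) ∙ ((1# - X (1 ℕ.+ 2 * s)) ∙ P⁻¹ s))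
    jump-suc n s = *-congˡ (*-cong (X-+ (1 ℕ.+ 2 * n) (s * (1 ℕ.+ 2 * n)))
      (≈-trans (*-congʳ (+-congˡ (-‿cong (≈-reflexive (cong X (ℕₚ.*-suc 2 s)))))) (P⁻¹-suc s)))

    term-suc : ∀ n s → jump n s + term (suc n) s ≈ term n s + jump n (suc s)
    term-suc n s = begin
      jump n s + term (suc n) s
        ≈⟨ +-congˡ (*-cong (≈-trans (P-suc n) (*-congʳ (*-congˡ (+-congˡ (-‿cong (X-+ 1 (1 ℕ.+ 2 * n)))))))
             (*-congˡ (≈-trans (≈-reflexive (cong X (*-next-odd s n))) (X-+ (s * (1 ℕ.+ 2 * n)) (2 * s))))) ⟩
      p ∙ u ∙ (g ∙ ((1# - t) ∙ p⁻¹)) + p ∙ (1# - x ∙ y) ∙ u ∙ (p⁻¹ ∙ (g ∙ t))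
        -- Both sides equal p u p⁻¹ g (1 - x y t).
        ≈⟨ solve 7 (λ p u g t p⁻¹ x y →
             p :* u :* (g :* ((𝟏 :- t) :* p⁻¹)) :+ p :* (𝟏 :- x :* y) :* u :* (p⁻¹ :* (g :* t)) :=
             (u :* (𝟏 :- y)) :* (p :* (p⁻¹ :* g)) :+ p :* u :* (y :* g :* ((𝟏 :- x :* t) :* p⁻¹)))
             ≈-refl p u g t p⁻¹ x y ⟩
      u ∙ (1# - y) ∙ (p ∙ (p⁻¹ ∙ g)) + p ∙ u ∙ (y ∙ g ∙ ((1# - x ∙ t) ∙ p⁻¹))
        ≈⟨ +-cong (≈-trans (*-congʳ (U-inv n)) (*-identityˡ _))
             (≈-sym (≈-trans (jump-suc n s) (*-congˡ (*-congˡ (*-congʳ (+-congˡ (-‿cong (X-+ 1 (2 * s))))))))) ⟩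
      term n s + jump n (suc s) ∎
      where
      p = P n
      u = U n
      p⁻¹ = P⁻¹ s
      x = X 1
      y = X (1 ℕ.+ 2 * n)
      t = X (2 * s)
      g = X (s * (1 ℕ.+ 2 * n))

    ∑-term-suc : ∀ n S → ∑ S (term (suc n)) ≈ ∑ S (term n) + jump n S
    ∑-term-suc n zero    = ≈-sym (≈-trans (+-identityˡ _) (jump-zero n))
    ∑-term-suc n (suc S) = begin
      ∑ (suc S) (term (suc n))                        ≈⟨ ∑-snoc S _ ⟩
      ∑ S (term (suc n)) + term (suc n) S             ≈⟨ +-congʳ (∑-term-suc n S) ⟩
      ∑ S (term n) + jump n S + term (suc n) S        ≈⟨ +-assoc _ _ _ ⟩
      ∑ S (term n) + (jump n S + term (suc n) S)      ≈⟨ +-congˡ (term-suc n S) ⟩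
      ∑ S (term n) + (term n S + jump n (suc S))      ≈⟨ +-assoc _ _ _ ⟨
      ∑ S (term n) + term n S + jump n (suc S)        ≈⟨ +-congʳ (∑-snoc S _) ⟨
      ∑ (suc S) (term n) + jump n (suc S)             ∎

    -- Passing from n to n + 1 adds two triangular powers on the left. On the right these are the
    -- new diagonal term `term n n` and the remainder `jump n (suc n)`.
    shanks : ∀ n → ∑ (2 * n) (X ∘ triangular) ≈ ∑ n (term n)
    shanks zero    = ≈-refl
    shanks (suc n) = begin
      ∑ (2 * suc n) (X ∘ triangular)
        ≡⟨ cong (λ k → ∑ k (X ∘ triangular)) (ℕₚ.*-suc 2 n) ⟩
      ∑ (2 ℕ.+ 2 * n) (X ∘ triangular)
        ≈⟨ ≈-trans (∑-snoc (1 ℕ.+ 2 * n) (X ∘ triangular)) (+-congʳ (∑-snoc (2 * n) (X ∘ triangular))) ⟩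
      ∑ (2 * n) (X ∘ triangular) + X (triangular (2 * n)) + X (triangular (1 ℕ.+ 2 * n))
        ≈⟨ +-cong (+-cong (shanks n) diagonal) last ⟩
      ∑ n (term n) + term n n + jump n (suc n)
        ≈⟨ +-congʳ (∑-snoc n _) ⟨
      ∑ (suc n) (term n) + jump n (suc n)
        ≈⟨ ∑-term-suc n (suc n) ⟨
      ∑ (suc n) (term (suc n)) ∎
      where
      y = X (1 ℕ.+ 2 * n)
      g = X (n * (1 ℕ.+ 2 * n))

      diagonal : X (triangular (2 * n)) ≈ term n n
      diagonal = begin
        X (triangular (2 * n))     ≡⟨ cong X (triangular-2* n) ⟩
        g                          ≈⟨ *-identityˡ g ⟨
        1# ∙ g                     ≈⟨ *-congʳ (P-inv n) ⟨
        P n ∙ P⁻¹ n ∙ g            ≈⟨ *-assoc _ _ _ ⟩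
        term n n                   ∎

      last : X (triangular (1 ℕ.+ 2 * n)) ≈ jump n (suc n)
      last = begin
        X (triangular (1 ℕ.+ 2 * n))
          ≈⟨ ≈-trans (X-+ (1 ℕ.+ 2 * n) (triangular (2 * n))) (*-congˡ (≈-reflexive (cong X (triangular-2* n)))) ⟩
        y ∙ g
          ≈⟨ ≈-trans (*-cong (P-inv n) (*-congʳ (U-inv n))) (≈-trans (*-identityˡ _) (*-identityˡ _)) ⟨
        P n ∙ P⁻¹ n ∙ (U n ∙ (1# - y) ∙ (y ∙ g))
          ≈⟨ solve 5 (λ p r u y g → p :* r :* (u :* (𝟏 :- y) :* (y :* g)) :=
               p :* u :* (y :* g :* ((𝟏 :- y) :* r))) ≈-refl (P n) (P⁻¹ n) (U n) y g ⟩
        P n ∙ U n ∙ (y ∙ g ∙ ((1# - y) ∙ P⁻¹ n))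
          ≈⟨ jump-suc n n ⟨
        jump n (suc n) ∎

    -- When x^{2n+3} is zero, the terms with s > 0 of the finite identity vanish and only P (n+1) is
    -- left.
    gauss : ∀ n → X (1 ℕ.+ 2 * suc n) ≈ 0# → ∑ (2 * suc n) (X ∘ triangular) ≈ A (suc n) ∙ B⁻¹ (suc n)
    gauss n Xn≈0 = begin
      ∑ (2 * suc n) (X ∘ triangular)                              ≈⟨ shanks (suc n) ⟩
      term (suc n) 0 + ∑ n (term (suc n) ∘ suc)                   ≈⟨ +-cong first (∑-zero n rest) ⟩
      P (suc n) + 0#                                              ≈⟨ +-identityʳ _ ⟩
      P (suc n)                                                   ∎
      where
      P⁻¹-zero : P⁻¹ 0 ≈ 1#
      P⁻¹-zero = begin
        B 0 ∙ A⁻¹ 0   ≈⟨ *-congʳ (≈-trans B-zero (≈-sym A-zero)) ⟩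
        A 0 ∙ A⁻¹ 0   ≈⟨ A-inv 0 ⟩
        1#            ∎
      first : term (suc n) 0 ≈ P (suc n)
      first = ≈-trans (*-congˡ (≈-trans (*-cong P⁻¹-zero X-zero) (*-identityˡ 1#))) (*-identityʳ _)
      rest : ∀ s → term (suc n) (suc s) ≈ 0#
      rest s = begin
        P (suc n) ∙ (P⁻¹ (suc s) ∙ X (suc s * (1 ℕ.+ 2 * suc n)))
          ≈⟨ *-congˡ (*-congˡ (≈-trans (X-+ (1 ℕ.+ 2 * suc n) _) (*-congʳ Xn≈0))) ⟩
        P (suc n) ∙ (P⁻¹ (suc s) ∙ (0# ∙ X (s * (1 ℕ.+ 2 * suc n))))
          ≈⟨ solve 3 (λ x y z → x :* (y :* (con 0ℤ :* z)) := con 0ℤ) ≈-refl _ _ _ ⟩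
        0# ∎

-- Summation of R

poch-0 : ∀ a b n → a 0 ≡ 0ℤ → poch a b n 0 ≡ 1ℤ
poch-0 a b zero    a₀≡0 = refl
poch-0 a b (suc n) a₀≡0 rewrite a₀≡0 | poch-0 a b n a₀≡0 = refl

q^-0 : ∀ c .{{_ : NonZero c}} → (q^ c) 0 ≡ 0ℤ
q^-0 (suc c) = refl

[1+n]C2 : ∀ n → suc n C 2 ≡ n ℕ.+ n C 2
[1+n]C2 n = trans (sym (nCk+nC[k+1]≡[n+1]C[k+1] n 1)) (cong (ℕ._+ n C 2) (nC1≡n n))

nC2+n≡triangular : ∀ n → n C 2 ℕ.+ n ≡ triangular n
nC2+n≡triangular zero    = refl
nC2+n≡triangular (suc n) = begin
  suc n C 2 ℕ.+ suc n       ≡⟨ ℕₚ.+-comm (suc n C 2) (suc n) ⟩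
  suc n ℕ.+ suc n C 2       ≡⟨ cong (suc n ℕ.+_) ([1+n]C2 n) ⟩
  suc n ℕ.+ (n ℕ.+ n C 2)   ≡⟨ cong (suc n ℕ.+_) (trans (ℕₚ.+-comm n (n C 2)) (nC2+n≡triangular n)) ⟩
  triangular (suc n)        ∎
  where open ≡-Reasoning

[1+n]n/2 : ∀ n → suc n * n / 2 ≡ n * (n ℕ.∸ 1) / 2 ℕ.+ n
[1+n]n/2 zero    = refl
[1+n]n/2 (suc n) = begin
  suc (suc n) * suc n / 2            ≡⟨ cong (_/ 2) (solve 1 (λ n → (con 2 :+ n) :* (con 1 :+ n) :=
                                          (con 1 :+ n) :* n :+ (con 1 :+ n) :* con 2) refl n) ⟩
  (suc n * n ℕ.+ suc n * 2) / 2      ≡⟨ +-distrib-/-∣ʳ (suc n * n) (divides (suc n) refl) ⟩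
  suc n * n / 2 ℕ.+ suc n * 2 / 2    ≡⟨ cong (suc n * n / 2 ℕ.+_) (m*n/n≡m (suc n) 2) ⟩
  suc n * n / 2 ℕ.+ suc n            ∎
  where
  open ≡-Reasoning
  open ℕSolver.+-*-Solver

-- A constant series rather than a scalar, so that signs take part in ring identities.
sign : ℕ → PowerSeries
sign j = (-1ℤ ℤ.^ j) · 𝟙

opaque
  pochq pochq⁻¹ : ℕ → ℕ → ℕ → PowerSeries
  pochq   c b n = poch (q^ c) b n
  pochq⁻¹ c b n = recip (poch (q^ c) b n)

module Truncated (N : ℕ) where
  open CommutativeRing (⋆-commutativeRing N) public
    using (setoid; _≈_; +-congˡ; -‿cong; *-identityˡ)
    renaming (refl to ≈-refl; sym to ≈-sym; trans to ≈-trans; reflexive to ≈-reflexive;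
              *-cong to ⊛-cong; *-congˡ to ⊛-congˡ; *-congʳ to ⊛-congʳ; _-_ to _⊟_)
  open QIdentities (⋆-commutativeRing N) public
  open IntegerCoefficients (⋆-commutativeRing N) public using (module Solver)

  q^-cong : ∀ {a b} → a ≡ b → q^ a ≈ q^ b
  q^-cong a≡b = ≈-reflexive (cong q^_ a≡b)

  q^-large : ∀ {c} → N ℕ.< c → q^ c ≈ 𝟘
  q^-large {c} N<c = agree λ {i} i≤N → q^-below c i (ℕₚ.≤-<-trans i≤N N<c)

  opaque
    unfolding _⊛_ pochq

    ⊛≈⋆ : ∀ f g → f ⊛ g ≈ f ⋆ g
    ⊛≈⋆ f g = ≈-refl

    q^-+-≈ : ∀ a b → q^ (a ℕ.+ b) ≈ q^ a ⊛ q^ b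
    q^-+-≈ a b = ≗⇒≈ (q^-+ a b)

    ⊛-recip : ∀ f → f 0 ≡ 1ℤ → f ⊛ recip f ≈ 𝟙
    ⊛-recip f f₀ = ≗⇒≈ (⋆-recip f f₀)

    𝟙-q^-unit : ∀ c .{{_ : NonZero c}} → (𝟙 ⊟ q^ c) ⊛ recip (𝟙 ⊟ q^ c) ≈ 𝟙
    𝟙-q^-unit c = ≗⇒≈ (⋆-recip (𝟙 ⊖ q^ c) (cong (λ x → 1ℤ ℤ.- x) (q^-0 c)))

    poch-suc : ∀ a b n → poch a b (suc n) ≈ (𝟙 ⊟ a ⊛ q^ (b * n)) ⊛ poch a b n
    poch-suc a b n = ≈-refl

    ⊝≈⊟ : ∀ f → ⊝ f ≈ ⊟ f
    ⊝≈⊟ f = ≈-refl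

    sign-zero : sign 0 ≈ 𝟙
    sign-zero = ≗⇒≈ λ i → ℤₚ.*-identityˡ (𝟙 i)

    sign-suc : ∀ j → sign (suc j) ≈ ⊟ sign j
    sign-suc j = ≗⇒≈ λ i → trans (ℤₚ.*-assoc -1ℤ (-1ℤ ℤ.^ j) (𝟙 i)) (ℤₚ.-1*i≡-i _)

    pochq≈poch : ∀ c b n → pochq c b n ≈ poch (q^ c) b n
    pochq≈poch c b n = ≈-refl

    pochq-inv : ∀ c b n .{{_ : NonZero c}} → pochq c b n ⊛ pochq⁻¹ c b n ≈ 𝟙
    pochq-inv c b n = ⊛-recip (poch (q^ c) b n) (poch-0 (q^ c) b n (q^-0 c))

    pochq-zero : ∀ c b → pochq c b 0 ≈ 𝟙
    pochq-zero c b = ≈-refl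

    pochq⁻¹-zero : ∀ c b → pochq⁻¹ c b 0 ≈ 𝟙
    pochq⁻¹-zero c b = ≈-trans (≈-sym (*-identityˡ (recip 𝟙))) (⊛-recip 𝟙 refl)

    pochq-suc : ∀ c b n → pochq c b (suc n) ≈ (𝟙 ⊟ q^ (c ℕ.+ b * n)) ⊛ pochq c b n
    pochq-suc c b n = ⊛-congʳ {poch (q^ c) b n} (+-congˡ {𝟙} (-‿cong (≈-sym (q^-+-≈ c (b * n)))))

    ∑-at : ∀ K f i → ∑ K f i ≡ ∑< K (λ n → f n i)
    ∑-at zero    f i = refl
    ∑-at (suc K) f i = cong (ℤ._+_ (f 0 i)) (∑-at K (f ∘ suc) i)

    diag-at : ∀ n F i → diag F n i ≡ ∑< (suc n) (λ j → F (n ℕ.∸ j) j i)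
    diag-at zero    F i = sym (ℤₚ.+-identityʳ _)
    diag-at (suc n) F i = cong (ℤ._+_ (F (suc n) 0 i)) (diag-at n (λ k j → F k (suc j)) i)

  pochq⁻¹-step : ∀ b k .{{_ : NonZero b}} → (𝟙 ⊟ q^ (b * suc k)) ⊛ pochq⁻¹ b b (suc k) ≈ pochq⁻¹ b b k
  pochq⁻¹-step b k = ≈-trans
    (⊛-congʳ (+-congˡ (-‿cong (q^-cong (ℕₚ.*-suc b k)))))
    (recip-step (pochq-suc b b k) (pochq-inv b b k) (pochq-inv b b (suc k)))

-- Evaluation of r(1,1,v,2;n) for v = 1 and v = 2

α : ℕ → PowerSeries
α = pochq⁻¹ 1 1

-- The exponent of q in r(1,1,v,2;n). Here w - uℓ = 1, so it is a natural number and no principal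
-- part arises.
βexp : ℕ → ℕ → ℕ
βexp v j = v * (j * (j ℕ.∸ 1) / 2) ℕ.+ j

β : ℕ → ℕ → PowerSeries
β v j = sign j ⊛ (q^ βexp v j ⊛ pochq⁻¹ v v j)

βexp-suc : ∀ v j → βexp v (suc j) ≡ 1 ℕ.+ (v * j ℕ.+ βexp v j)
βexp-suc v j = trans (cong (λ t → v * t ℕ.+ suc j) ([1+n]n/2 j))
  (solve 3 (λ v t j → v :* (t :+ j) :+ (con 1 :+ j) := con 1 :+ (v :* j :+ (v :* t :+ j))) refl
    v (j * (j ℕ.∸ 1) / 2) j)
  where open ℕSolver.+-*-Solver

module _ (N v : ℕ) .{{_ : NonZero v}} where
  open Truncated N
  open Relation.Binary.Reasoning.Setoid setoid

  β-zero : β v 0 ≈ 𝟙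
  β-zero = begin
    sign 0 ⊛ (q^ βexp v 0 ⊛ pochq⁻¹ v v 0)
      ≈⟨ ⊛-cong sign-zero (⊛-cong (q^-cong (trans (ℕₚ.+-identityʳ _) (ℕₚ.*-zeroʳ v))) (pochq⁻¹-zero v v)) ⟩
    𝟙 ⊛ (𝟙 ⊛ 𝟙)
      ≈⟨ ≈-trans (*-identityˡ (𝟙 ⊛ 𝟙)) (*-identityˡ 𝟙) ⟩
    𝟙 ∎

  β-step : ∀ j → (𝟙 ⊟ q^ (v * suc j)) ⊛ β v (suc j) ≈ ⊟ (q^ 1 ⊛ q^ (v * j) ⊛ β v j)
  β-step j = begin
    t ⊛ (sign (suc j) ⊛ (q^ βexp v (suc j) ⊛ ρ))
      ≈⟨ ⊛-congˡ (⊛-cong (sign-suc j) (⊛-congʳ (≈-trans (q^-cong (βexp-suc v j))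
           (≈-trans (q^-+-≈ 1 (v * j ℕ.+ βexp v j)) (⊛-congˡ (q^-+-≈ (v * j) (βexp v j))))))) ⟩
    t ⊛ (⊟ sign j ⊛ (q^ 1 ⊛ (q^ (v * j) ⊛ q^ βexp v j) ⊛ ρ))
      ≈⟨ solve 6 (λ t s q y e r → t :* (:- s :* (q :* (y :* e) :* r)) := :- (q :* y :* (s :* (e :* (t :* r))))) ≈-refl
           t (sign j) (q^ 1) (q^ (v * j)) (q^ βexp v j) ρ ⟩
    ⊟ (q^ 1 ⊛ q^ (v * j) ⊛ (sign j ⊛ (q^ βexp v j ⊛ (t ⊛ ρ))))
      ≈⟨ -‿cong (⊛-congˡ (⊛-congˡ (⊛-congˡ (pochq⁻¹-step v j)))) ⟩
    ⊟ (q^ 1 ⊛ q^ (v * j) ⊛ β v j) ∎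
    where
    open Solver
    t = 𝟙 ⊟ q^ (v * suc j)
    ρ = pochq⁻¹ v v (suc j)

  α-step : ∀ k → (𝟙 ⊟ q^ suc k) ⊛ α (suc k) ≈ α k
  α-step k = ≈-trans (⊛-congʳ (+-congˡ (-‿cong (q^-cong (sym (ℕₚ.*-identityˡ (suc k))))))) (pochq⁻¹-step 1 k)

  module Conv = Convolution (q^ 1) q^_ (λ j → q^ (v * j)) α (β v)
    ≈-refl (q^-+-≈ 1) (q^-cong (ℕₚ.*-zeroʳ v)) α-step β-step

  conv-zero : Weighted.conv α (β v) 0 ≈ 𝟙
  conv-zero = begin
    Weighted.conv α (β v) 0       ≈⟨ Weighted.conv≈diag α (β v) 0 ⟩
    α 0 ⊛ β v 0       ≈⟨ ⊛-cong (pochq⁻¹-zero 1 1) β-zero ⟩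
    𝟙 ⊛ 𝟙             ≈⟨ *-identityˡ 𝟙 ⟩
    𝟙                 ∎

module _ (N : ℕ) where
  open Truncated N
  open Relation.Binary.Reasoning.Setoid setoid

  conv-v=1 : ∀ n → Weighted.conv α (β 1) n ≈ 𝟙
  conv-v=1 zero    = conv-zero N 1
  conv-v=1 (suc n) = ≈-trans
    -- In power series 1 - q^{n+1} is invertible, having constant coefficient 1.
    (*-cancelˡ-unit (𝟙-q^-unit (suc n))
      (Conv.conv-recurrence-v=1 N 1 (λ j → q^-cong (ℕₚ.*-identityˡ j)) q^-+-≈ n))
    (conv-v=1 n)

  conv-v=2 : ∀ n → Weighted.conv α (β 2) n ≈ pochq⁻¹ 2 2 n
  conv-v=2 zero    = ≈-trans (conv-zero N 2) (≈-sym (pochq⁻¹-zero 2 2))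
  conv-v=2 (suc n) = *-cancelˡ-unit (𝟙-q^-unit (2 * suc n)) (≈-trans
    (Conv.conv-recurrence-v=2 N 2 Y-+ n)
    (≈-trans (conv-v=2 n) (≈-sym (pochq⁻¹-step 2 n))))
    where
    Y-+ : ∀ k j → q^ (2 * (k ℕ.+ j)) ≈ q^ k ⊛ q^ k ⊛ q^ (2 * j)
    Y-+ k j = begin
      q^ (2 * (k ℕ.+ j))            ≡⟨ cong q^_ (solve 2 (λ k j → con 2 :* (k :+ j) := k :+ k :+ con 2 :* j) refl k j) ⟩
      q^ (k ℕ.+ k ℕ.+ 2 * j)        ≈⟨ q^-+-≈ (k ℕ.+ k) (2 * j) ⟩
      q^ (k ℕ.+ k) ⊛ q^ (2 * j)     ≈⟨ ⊛-congʳ (q^-+-≈ k k) ⟩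
      q^ k ⊛ q^ k ⊛ q^ (2 * j)      ∎
      where open ℕSolver.+-*-Solver

-- From Laurent coefficients to Cauchy products

recip[q,q]-∸ : ∀ n j → j ℕ.≤ n → recip[q,q] (+ n ℤ.- + j) ≡ recip (poch (q^ 1) 1 (n ℕ.∸ j))
recip[q,q]-∸ n j j≤n = cong recip[q,q] (trans (ℤₚ.m-n≡m⊖n n j) (ℤₚ.⊖-≥ j≤n))

⌞⌟-⊖ : ∀ e f n → ⌞ f ⌟ (n ℤ.⊖ e) ≡ (q^ e ⋆ f) n
⌞⌟-⊖ zero    f n       = sym (⋆-identityˡ f n)
⌞⌟-⊖ (suc e) f zero    = refl
⌞⌟-⊖ (suc e) f (suc n) = trans (cong ⌞ f ⌟ (ℤₚ.[1+m]⊖[1+n]≡m⊖n n e))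
  (trans (⌞⌟-⊖ e f n) (sym (ℤₚ.+-identityˡ _)))

shift-⌞⌟ : ∀ e f k → shift (+ e) ⌞ f ⌟ k ≡ ⌞ q^ e ⋆ f ⌟ k
shift-⌞⌟ e       f (+ n)    = trans (cong ⌞ f ⌟ (ℤₚ.m-n≡m⊖n n e)) (⌞⌟-⊖ e f n)
shift-⌞⌟ zero    f -[1+ n ] = refl
shift-⌞⌟ (suc e) f -[1+ n ] = refl

⌞⌟-cong : ∀ {f g} → f ≗ g → ∀ k → ⌞ f ⌟ k ≡ ⌞ g ⌟ k
⌞⌟-cong f≗g (+ n)    = f≗g n
⌞⌟-cong f≗g -[1+ n ] = refl

opaque
  unfolding _⊛_ pochq

  sign-⋆ : ∀ j f → sign j ⋆ f ≗ (-1ℤ ℤ.^ j) · f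
  sign-⋆ j f i = trans (·-⋆ (-1ℤ ℤ.^ j) 𝟙 f i) (cong (ℤ._*_ (-1ℤ ℤ.^ j)) (⋆-identityˡ f i))

  sign-β : ∀ v n j i → (-1ℤ ℤ.^ j) ℤ.* (q^ βexp v j ⋆ (recip (poch (q^ 1) 1 (n ℕ.∸ j)) ⋆ recip (poch (q^ v) v j))) i ≡
           (sign j ⊛ (q^ βexp v j ⊛ (α (n ℕ.∸ j) ⊛ pochq⁻¹ v v j))) i
  sign-β v n j i = sym (sign-⋆ j (q^ βexp v j ⊛ (α (n ℕ.∸ j) ⊛ pochq⁻¹ v v j)) i)

shift-cong : ∀ e {F G} → (∀ k → F k ≡ G k) → ∀ k → shift e F k ≡ shift e G k
shift-cong e F≡G k = F≡G (k ℤ.- e)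

r≡∑ : ∀ v n .{{_ : NonZero v}} k → r 1 1 v 2 n k ≡
      ∑< (suc n) (λ j → (-1ℤ ℤ.^ j) ℤ.* ⌞ q^ βexp v j ⋆ (recip (poch (q^ 1) 1 (n ℕ.∸ j)) ⋆ recip (poch (q^ v) v j)) ⌟ k)
r≡∑ v n k = ∑<-cong (suc n) λ { j (s≤s j≤n) → cong (ℤ._*_ (-1ℤ ℤ.^ j)) (begin
  shift (+ (1 * v * (j * (j ℕ.∸ 1) / 2)) ℤ.+ 1ℤ ℤ.* + j)
        ⌞ recip[q,q] (+ n ℤ.- + (1 * j)) ⋆ recip (poch (q^ (1 * v)) (1 * v) j) ⌟ k
    ≡⟨ cong₂ (λ w i → shift (+ (w * (j * (j ℕ.∸ 1) / 2)) ℤ.+ i)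
         ⌞ recip[q,q] (+ n ℤ.- + (1 * j)) ⋆ recip (poch (q^ w) w j) ⌟ k) (ℕₚ.*-identityˡ v) (ℤₚ.*-identityˡ (+ j)) ⟩
  shift (+ βexp v j) ⌞ recip[q,q] (+ n ℤ.- + (1 * j)) ⋆ recip (poch (q^ v) v j) ⌟ k
    ≡⟨ cong (λ f → shift (+ βexp v j) ⌞ f ⋆ recip (poch (q^ v) v j) ⌟ k)
         (trans (cong (λ i → recip[q,q] (+ n ℤ.- + i)) (ℕₚ.*-identityˡ j)) (recip[q,q]-∸ n j j≤n)) ⟩
  shift (+ βexp v j) ⌞ recip (poch (q^ 1) 1 (n ℕ.∸ j)) ⋆ recip (poch (q^ v) v j) ⌟ k
    ≡⟨ shift-⌞⌟ (βexp v j) _ k ⟩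
  ⌞ q^ βexp v j ⋆ (recip (poch (q^ 1) 1 (n ℕ.∸ j)) ⋆ recip (poch (q^ v) v j)) ⌟ k ∎) }
  where open ≡-Reasoning

-- Exact equality follows from the congruences for all `N`: the coefficient of degree i is read off
-- modulo q^{i+1}.
r≡conv : ∀ v n .{{_ : NonZero v}} (f : PowerSeries) → (∀ N → Truncated.Weighted.conv N α (β v) n ≈[ N ] f) →
         ∀ k → r 1 1 v 2 n k ≡ ⌞ f ⌟ k
r≡conv v n f conv≈f -[1+ i ] = trans (r≡∑ v n -[1+ i ])
  (∑<-zero (suc n) _ λ j _ → ℤₚ.*-zeroʳ (-1ℤ ℤ.^ j))
r≡conv v n f conv≈f (+ i)    = begin
  r 1 1 v 2 n (+ i)
    ≡⟨ r≡∑ v n (+ i) ⟩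
  ∑< (suc n) (λ j → (-1ℤ ℤ.^ j) ℤ.* (q^ βexp v j ⋆ (recip (poch (q^ 1) 1 (n ℕ.∸ j)) ⋆ recip (poch (q^ v) v j))) i)
    ≡⟨ ∑<-cong (suc n) (λ j _ → trans (sign-β v n j i) (rearrange j)) ⟩
  ∑< (suc n) (λ j → (α (n ℕ.∸ j) ⊛ β v j) i)
    ≡⟨ diag-at n (λ k j → α k ⊛ β v j) i ⟨
  diag (λ k j → α k ⊛ β v j) n i
    ≡⟨ at (≈-trans (≈-sym (Weighted.conv≈diag α (β v) n)) (conv≈f i)) ℕₚ.≤-refl ⟩
  f i ∎
  where
  open ≡-Reasoning
  open Truncated i
  rearrange : ∀ j → (sign j ⊛ (q^ βexp v j ⊛ (α (n ℕ.∸ j) ⊛ pochq⁻¹ v v j))) i ≡ (α (n ℕ.∸ j) ⊛ β v j) i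
  rearrange j = at (solve 4 (λ s e a b → s :* (e :* (a :* b)) := a :* (s :* (e :* b))) ≈-refl
    (sign j) (q^ βexp v j) (α (n ℕ.∸ j)) (pochq⁻¹ v v j)) ℕₚ.≤-refl
    where open Solver

-- Convergence and the final sums

∑<-stable : ∀ {K L} f → K ℕ.≤ L → (∀ i → K ℕ.≤ i → f i ≡ 0ℤ) → ∑< L f ≡ ∑< K f
∑<-stable {L = L} f z≤n       f≡0 = ∑<-zero L f λ i _ → f≡0 i z≤n
∑<-stable         f (s≤s K≤L) f≡0 = cong (ℤ._+_ (f 0)) (∑<-stable (f ∘ suc) K≤L λ i K≤i → f≡0 (suc i) (s≤s K≤i))

-- As `g n` starts in degree n or later, the coefficient of degree i is the same in all partial sums
-- longer than i. One convenient length `K i` per degree, chosen to fit the finite identity at hand,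
-- is then enough.
sumsTo-⌞⌟ : ∀ (F : ℕ → Laurent) (g : ℕ → PowerSeries) (S : PowerSeries) (K : ℕ → ℕ) →
  (∀ n k → F n k ≡ ⌞ g n ⌟ k) → (∀ n i → i ℕ.< n → g n i ≡ 0ℤ) →
  (∀ i → i ℕ.< K i) → (∀ i → ∑< (K i) (λ n → g n i) ≡ S i) → F sumsTo ⌞ S ⌟
sumsTo-⌞⌟ F g S K F≡g g≡0 i<K ∑≡S = λ where
    (+ N)    → suc N , λ L N<L → λ where
      (+ i)    (ℤ.+≤+ i≤N) → partial-sum i L (ℕₚ.≤-trans (s≤s i≤N) N<L)
      -[1+ i ] _           → principal-part i L
    -[1+ N ] → 0 , λ where
      L _ -[1+ i ] _ → principal-part i L
  where
  open ≡-Reasoning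
  principal-part : ∀ i L → ∑< L (λ n → F n -[1+ i ]) ≡ 0ℤ
  principal-part i L = ∑<-zero L _ λ n _ → F≡g n -[1+ i ]
  partial-sum : ∀ i L → i ℕ.< L → ∑< L (λ n → F n (+ i)) ≡ S i
  partial-sum i L i<L = begin
    ∑< L (λ n → F n (+ i))    ≡⟨ ∑<-cong L (λ n _ → F≡g n (+ i)) ⟩
    ∑< L (λ n → g n i)        ≡⟨ ∑<-stable _ i<L (λ n → g≡0 n i) ⟩
    ∑< (suc i) (λ n → g n i)  ≡⟨ ∑<-stable _ (i<K i) (λ n → g≡0 n i) ⟨
    ∑< (K i) (λ n → g n i)    ≡⟨ ∑≡S i ⟩
    S i                       ∎

-- Euler's identity at z = q^t and p = q²; the first two identities of the theorem differ only in t.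
R-v=2 : ∀ t .{{_ : NonZero t}} → R 2 t 1 1 2 2 sumsTo ⌞ poch∞ (⊝ q^ t) 2 ⌟
R-v=2 t = sumsTo-⌞⌟ (R 2 t 1 1 2 2) (λ n → q^ e n ⋆ pochq⁻¹ 2 2 n) (poch∞ (⊝ q^ t) 2) (λ N → 2 ℕ.+ N)
  (λ n k → trans (shift-cong (+ e n) (r≡conv 2 n (pochq⁻¹ 2 2 n) λ N → conv-v=2 N n) k) (shift-⌞⌟ (e n) (pochq⁻¹ 2 2 n) k))
  (λ n i i<n → trans (⋆-comm (q^ e n) (pochq⁻¹ 2 2 n) i) (⋆q^-below (pochq⁻¹ 2 2 n) (e n) i (ℕₚ.<-≤-trans i<n (n≤e n))))
  (λ N → s≤s (ℕₚ.n≤1+n N))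
  λ N → begin
    ∑< (2 ℕ.+ N) (λ n → (q^ e n ⋆ pochq⁻¹ 2 2 n) N)
      ≡⟨ ∑<-cong (2 ℕ.+ N) (λ n _ → at (Truncated.⊛≈⋆ N (q^ e n) (pochq⁻¹ 2 2 n)) ℕₚ.≤-refl) ⟨
    ∑< (2 ℕ.+ N) (λ n → (q^ e n ⊛ pochq⁻¹ 2 2 n) N)
      ≡⟨ Truncated.∑-at N (2 ℕ.+ N) (λ n → q^ e n ⊛ pochq⁻¹ 2 2 n) N ⟨
    Truncated.∑ N (2 ℕ.+ N) (λ n → q^ e n ⊛ pochq⁻¹ 2 2 n) N
      ≡⟨ at (sum N) ℕₚ.≤-refl ⟩
    poch∞ (⊝ q^ t) 2 N ∎
  where
  open ≡-Reasoning
  e : ℕ → ℕ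
  e n = 2 * (n C 2) ℕ.+ t * n
  n≤e : ∀ n → n ℕ.≤ e n
  n≤e n = ℕₚ.≤-trans (ℕₚ.m≤n*m n t) (ℕₚ.m≤n+m (t * n) (2 * (n C 2)))
  e-suc : ∀ n → e (suc n) ≡ t ℕ.+ 2 * n ℕ.+ e n
  e-suc n = trans (cong (λ b → 2 * b ℕ.+ t * suc n) ([1+n]C2 n))
    (solve 3 (λ n b t → con 2 :* (n :+ b) :+ t :* (con 1 :+ n) := t :+ con 2 :* n :+ (con 2 :* b :+ t :* n)) refl
      n (n C 2) t)
    where open ℕSolver.+-*-Solver
  module _ (N : ℕ) where
    open Truncated N
    product : ∀ i → ∏ i (λ k → 𝟙 ⊞ q^ t ⊛ q^ (2 * k)) ≈ poch (⊝ q^ t) 2 i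
    product zero    = ≈-refl
    product (suc i) = ≈-trans
      (⊛-cong (≈-trans
        (Solver.solve 2 (λ z y → con 1ℤ :+ z :* y := con 1ℤ :- (:- z) :* y) ≈-refl (q^ t) (q^ (2 * i)))
        (+-congˡ (-‿cong (⊛-congʳ (≈-sym (⊝≈⊟ (q^ t)))))))
        (product i))
      (≈-sym (poch-suc (⊝ q^ t) 2 i))
      where open Solver using (con; _:+_; _:*_; _:-_; :-_; _:=_)
    W-sucʳ : ∀ i n → q^ (i * (2 * suc n)) ≈ q^ (2 * i) ⊛ q^ (i * (2 * n))
    W-sucʳ i n = ≈-trans
      (q^-cong (solve 2 (λ i n → i :* (con 2 :* (con 1 :+ n)) := con 2 :* i :+ i :* (con 2 :* n)) refl i n))
      (q^-+-≈ (2 * i) (i * (2 * n)))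
      where open ℕSolver.+-*-Solver
    E-suc : ∀ n → q^ e (suc n) ≈ q^ t ⊛ q^ (2 * n) ⊛ q^ e n
    E-suc n = ≈-trans (q^-cong (e-suc n)) (≈-trans (q^-+-≈ (t ℕ.+ 2 * n) (e n)) (⊛-congʳ (q^-+-≈ t (2 * n))))
    sum : ∑ (2 ℕ.+ N) (λ n → q^ e n ⊛ pochq⁻¹ 2 2 n) ≈ poch (⊝ q^ t) 2 (suc N)
    sum = ≈-trans
      (Euler.euler (q^ t) (λ n → q^ (2 * n)) (λ n → q^ e n) (pochq⁻¹ 2 2) (λ i n → q^ (i * (2 * n)))
        (q^-cong (ℕₚ.*-zeroʳ t)) E-suc (pochq⁻¹-zero 2 2) (λ n → pochq⁻¹-step 2 n)
        (λ n → ≈-refl) (λ i → q^-cong (ℕₚ.*-zeroʳ i)) (λ i n → q^-+-≈ (2 * n) (i * (2 * n))) W-sucʳ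
        -- Index N + 1 is large enough for both vanishing conditions, and N + 1 is also the number
        -- of factors from which `poch∞` reads degree N.
        {suc N} (q^-large (n≤e (suc N))) {suc N} (q^-large (ℕₚ.m≤n*m (suc N) 2)))
      (product (suc N))

-- Each degree i of `poch∞` is read from its own product of i + 1 factors; `poch-limit` with N - i
-- extra factors moves all degrees up to N to a common product.
poch∞≈poch : ∀ a b .{{_ : NonZero b}} N → poch∞ a b ≈[ N ] poch a b (suc N)
poch∞≈poch a b N = agree λ {i} i≤N → sym (subst (λ n → poch a b n i ≡ poch∞ a b i)
  (trans (ℕₚ.+-suc (N ℕ.∸ i) i) (cong suc (ℕₚ.m∸n+n≡m i≤N))) (poch-limit a b i (N ℕ.∸ i)))

-- The exponent m n(n-1)/2 + mn is m times a triangular number, so this is Gauss's identity at x =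
-- q^m.
R-v=1 : ∀ m .{{_ : NonZero m}} → R m m 1 1 1 2 sumsTo
        ⌞ poch∞ (q^ (2 * m)) (2 * m) {{m*n≢0 2 m}} ⊘ poch∞ (q^ m) (2 * m) {{m*n≢0 2 m}} ⌟
R-v=1 m = sumsTo-⌞⌟ (R m m 1 1 1 2) (λ n → q^ e n) (A∞ ⊘ B∞) (λ N → 2 * suc N)
  (λ n k → trans (shift-cong (+ e n) (r≡conv 1 n 𝟙 λ N → conv-v=1 N n) k)
    (trans (shift-⌞⌟ (e n) 𝟙 k) (⌞⌟-cong (λ i → trans (⋆-comm (q^ e n) 𝟙 i) (⋆-identityˡ (q^ e n) i)) k)))
  (λ n i i<n → q^-below (e n) i (ℕₚ.<-≤-trans i<n (ℕₚ.≤-trans (ℕₚ.m≤n*m n m) (ℕₚ.m≤n+m (m * n) (m * (n C 2))))))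
  (λ N → ℕₚ.m≤n*m (suc N) 2)
  λ N → trans (sym (Truncated.∑-at N (2 * suc N) (λ n → q^ e n) N)) (at (sum N) ℕₚ.≤-refl)
  where
  instance
    2m≢0 : NonZero (2 * m)
    2m≢0 = m*n≢0 2 m
  A∞ B∞ : PowerSeries
  A∞ = poch∞ (q^ (2 * m)) (2 * m)
  B∞ = poch∞ (q^ m) (2 * m)
  e : ℕ → ℕ
  e n = m * (n C 2) ℕ.+ m * n
  e≡ : ∀ n → e n ≡ m * triangular n
  e≡ n = trans (sym (ℕₚ.*-distribˡ-+ m (n C 2) n)) (cong (m *_) (nC2+n≡triangular n))
  module _ (N : ℕ) where
    open Truncated N
    open Relation.Binary.Reasoning.Setoid setoid
    X : ℕ → PowerSeries
    X k = q^ (m * k)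
    X-+ : ∀ i j → X (i ℕ.+ j) ≈ X i ⊛ X j
    X-+ i j = ≈-trans (q^-cong (ℕₚ.*-distribˡ-+ m i j)) (q^-+-≈ (m * i) (m * j))
    A-suc : ∀ n → pochq (2 * m) (2 * m) (suc n) ≈ (𝟙 ⊟ X (2 ℕ.+ 2 * n)) ⊛ pochq (2 * m) (2 * m) n
    A-suc n = ≈-trans (pochq-suc (2 * m) (2 * m) n) (⊛-congʳ (+-congˡ (-‿cong (q^-cong
      (solve 2 (λ m n → con 2 :* m :+ con 2 :* m :* n := m :* (con 2 :+ con 2 :* n)) refl m n)))))
      where open ℕSolver.+-*-Solver
    B-suc : ∀ n → pochq m (2 * m) (suc n) ≈ (𝟙 ⊟ X (1 ℕ.+ 2 * n)) ⊛ pochq m (2 * m) n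
    B-suc n = ≈-trans (pochq-suc m (2 * m) n) (⊛-congʳ (+-congˡ (-‿cong (q^-cong
      (solve 2 (λ m n → m :+ con 2 :* m :* n := m :* (con 1 :+ con 2 :* n)) refl m n)))))
      where open ℕSolver.+-*-Solver
    N<exponent : N ℕ.< m * (1 ℕ.+ 2 * suc N)
    N<exponent = ℕₚ.≤-trans (ℕₚ.m≤n*m (suc N) 2) (ℕₚ.≤-trans (ℕₚ.n≤1+n _) (ℕₚ.m≤n*m _ m))
    sum : ∑ (2 * suc N) (λ n → q^ e n) ≈ A∞ ⊘ B∞
    sum = begin
      ∑ (2 * suc N) (λ n → q^ e n)
        ≈⟨ ∑-cong (2 * suc N) (λ n → q^-cong (e≡ n)) ⟩
      ∑ (2 * suc N) (X ∘ triangular)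
        ≈⟨ Shanks.gauss X (pochq (2 * m) (2 * m)) (pochq⁻¹ (2 * m) (2 * m)) (pochq m (2 * m)) (pochq⁻¹ m (2 * m))
             (q^-cong (ℕₚ.*-zeroʳ m)) X-+
             (pochq-zero (2 * m) (2 * m)) A-suc (λ n → pochq-inv (2 * m) (2 * m) n)
             (pochq-zero m (2 * m)) B-suc (λ n → pochq-inv m (2 * m) n)
             N (q^-large N<exponent) ⟩
      pochq (2 * m) (2 * m) (suc N) ⊛ pochq⁻¹ m (2 * m) (suc N)
        ≈⟨ ⊛-cong (≈-trans (pochq≈poch (2 * m) (2 * m) (suc N)) (≈-sym (poch∞≈poch (q^ (2 * m)) (2 * m) N)))
             -- The inverses belong to a finite product and to its limit, which agree only modulo
             -- q^{N+1}. Degree 0 of `B∞` is read from a single factor, hence the 1 in `poch-0`.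
             (recip-unique (≈-trans (pochq≈poch m (2 * m) (suc N)) (≈-sym (poch∞≈poch (q^ m) (2 * m) N)))
               (pochq-inv m (2 * m) (suc N)) (⊛-recip B∞ (poch-0 (q^ m) (2 * m) 1 (q^-0 m)))) ⟩
      A∞ ⊛ recip B∞
        ≈⟨ ⊛≈⋆ A∞ (recip B∞) ⟩
      A∞ ⊘ B∞ ∎

theorem1p3 : (R 2 1 1 1 2 2 sumsTo ⌞ poch∞ (⊝ q^ 1) 2 ⌟)
    × (R 2 2 1 1 2 2 sumsTo ⌞ poch∞ (⊝ q^ 2) 2 ⌟)
    × ((m : ℕ) .{{_ : NonZero m}} →
    R m m 1 1 1 2 sumsTo
    ⌞ poch∞ (q^ (2 * m)) (2 * m) {{m*n≢0 2 m}}
    ⊘ poch∞ (q^ m) (2 * m) {{m*n≢0 2 m}} ⌟)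
theorem1p3 = R-v=2 1 , R-v=2 2 , λ m → R-v=1 m
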